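{- Let $G = C_{16}(\{1,4,8\})$ and let $(s_1,\ldots,s_{16})$ be any $16$-tuple of positive integers. Then ${\rm Ind}(G^{(s_1,\ldots,s_{16})})$ is shellable but not vertex decomposable. Furthermore, for all $m \geq 1$, $G^{(m,\ldots,m)} = G[K_m]$ is a circulant graph whose independence complex is shellable but not vertex decomposable.
   Context: For $n\ge1$ and $S\subseteq\{1,\ldots,\lfloor n/2\rfloor\}$, the circulant graph $C_n(S)$ has vertex set $\{x_0,\ldots,x_{n-1}\}$, with $\{x_a,x_b\}$ an edge iff $|a-b|\in S$ or $n-|a-b|\in S$. For a graph $G$ on vertices $x_1,\ldots,x_n$ and positive integers $s_1,\ldots,s_n$, the expansion $G^{(s_1,\ldots,s_n)}$ is the graph on vertices $x_{i,j}$ ($1\le i\le n$, $1\le j\le s_i$) where $\{x_{i,j},x_{k,l}\}$ is an edge iff $\{x_i,x_k\}$ is an edge of $G$ or $i=k$ (distinct vertices). The lexicographical product $G[H]$ has vertex set $V_G\times V_H$, with $(w,x),(y,z)$ adjacent if $\{w,y\}\in E_G$, or $w=y$ and $\{x,z\}\in E_H$; $K_m$ is the complete graph on $m$ vertices. ${\rm Ind}(G)$ is the simplicial complex of independent sets of $G$. A pure simplicial complex $\Delta$ is shellable if its facets (maximal faces) can be ordered $F_1,\ldots,F_s$ so that for all $1\le j<i\le s$ there exist $x\in F_i\setminus F_j$ and $k<i$ with $\{x\}=F_i\setminus F_k$. A pure simplicial complex $\Delta$ is vertex decomposable if it has a unique facet, or there is a vertex $x$ such that ${\rm del}_\Delta(x)=\{F\in\Delta: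 x\notin F\}$ and ${\rm link}_\Delta(x)=\{F\in\Delta: x\notin F,\ F\cup\{x\}\in\Delta\}$ are vertex decomposable. -}

module Defs where

open import Data.Nat using (ℕ; zero; suc; _≤_; _<_; ∣_-_∣; _∸_; _/_)
open import Data.Fin using (Fin; toℕ)
open import Data.Bool using (Bool; T)
open import Data.List using (List)
open import Data.List.Membership.Propositional using (_∈_)
open import Data.List.Relation.Unary.All using (All)
open import Data.Product using (Σ; ∃; _×_; _,_; proj₁)
open import Data.Sum using (_⊎_)
open import Relation.Nullary using (¬_)
open import Relation.Binary.PropositionalEquality using (_≡_; _≢_)
open import Function.Bundles using (_↔_; _⇔_; Inverse)

record Graph : Set₁ where
  field
    V   : Set
    Adj : V → V → Set
open Graph public

_≅_ : Graph → Graph → Set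
G ≅ H = Σ (V G ↔ V H) λ f →
  ∀ x y → Adj G x y ⇔ Adj H (Inverse.to f x) (Inverse.to f y)

Circulant : ℕ → List ℕ → Graph
Circulant n S = record
  { V   = Fin n
  ; Adj = λ a b → (∣ toℕ a - toℕ b ∣ ∈ S) ⊎ ((n ∸ ∣ toℕ a - toℕ b ∣) ∈ S)
  }

ValidConnectionSet : ℕ → List ℕ → Set
ValidConnectionSet n S = All (λ k → 1 ≤ k × k ≤ n / 2) S

Expansion : (G : Graph) → (V G → ℕ) → Graph
Expansion G s = record
  { V   = Σ (V G) (λ i → Fin (s i))
  ; Adj = λ p q → Adj G (proj₁ p) (proj₁ q) ⊎ (proj₁ p ≡ proj₁ q × p ≢ q)
  }

Lex : Graph → Graph → Graph
Lex G H = record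
  { V   = V G × V H
  ; Adj = λ { (w , x) (y , z) → Adj G w y ⊎ (w ≡ y × Adj H x z) }
  }

K : ℕ → Graph
K m = record { V = Fin m ; Adj = λ a b → a ≢ b }

-- Simplicial complexes on a vertex type V; faces are (finite, since all
-- vertex types used here are finite) subsets V → Bool.

Subset : Set → Set
Subset V = V → Bool

_∋_ : {V : Set} → Subset V → V → Set
F ∋ v = T (F v)

_⊆_ : {V : Set} → Subset V → Subset V → Set
F ⊆ G = ∀ v → F ∋ v → G ∋ v

_≐_ : {V : Set} → Subset V → Subset V → Set
F ≐ G = F ⊆ G × G ⊆ F

Complex : Set → Set₁
Complex V = Subset V → Set

Ind : (G : Graph) → Complex (V G)
Ind G F = ∀ x y → F ∋ x → F ∋ y → ¬ Adj G x y

module _ {V : Set} where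

  Facet : Complex V → Subset V → Set
  Facet Δ F = Δ F × (∀ G → Δ G → F ⊆ G → G ⊆ F)

  SameSize : Subset V → Subset V → Set
  SameSize F G = Σ V (λ v → F ∋ v) ↔ Σ V (λ v → G ∋ v)

  Pure : Complex V → Set
  Pure Δ = ∀ F G → Facet Δ F → Facet Δ G → SameSize F G

  Shelling : Complex V → (s : ℕ) → (Fin s → Subset V) → Set
  Shelling Δ s L =
    (∀ i → Facet Δ (L i)) ×
    (∀ F → Facet Δ F → ∃ λ i → L i ≐ F) ×
    (∀ (i j : Fin s) → toℕ j < toℕ i →
       ∃ λ x → (L i ∋ x) × ¬ (L j ∋ x) ×
         ∃ λ (k : Fin s) → toℕ k < toℕ i ×
           (∀ y → ((L i ∋ y) × ¬ (L k ∋ y)) ⇔ (y ≡ x)))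

  Shellable : Complex V → Set
  Shellable Δ = Pure Δ × Σ ℕ λ s → Σ (Fin s → Subset V) λ L → Shelling Δ s L

  del : Complex V → V → Complex V
  del Δ x F = Δ F × ¬ (F ∋ x)

  link : Complex V → V → Complex V
  link Δ x F = Δ F × ¬ (F ∋ x) ×
    ∃ λ G → Δ G × (∀ v → (G ∋ v) ⇔ ((F ∋ v) ⊎ v ≡ x))

  IsVertex : Complex V → V → Set
  IsVertex Δ x = ∃ λ G → Δ G × (∀ v → (G ∋ v) ⇔ (v ≡ x))

  UniqueFacet : Complex V → Set
  UniqueFacet Δ = ∃ λ F → Facet Δ F × (∀ G → Facet Δ G → G ≐ F)

  data VertexDecomposable : Complex V → Set₁ where
    simplex : ∀ {Δ} → Pure Δ → UniqueFacet Δ → VertexDecomposable Δ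
    decomp  : ∀ {Δ} → Pure Δ → (x : V) → IsVertex Δ x →
              VertexDecomposable (del Δ x) →
              VertexDecomposable (link Δ x) →
              VertexDecomposable Δ

G₁₆ : Graph
G₁₆ = Circulant 16 (1 List.∷ 4 List.∷ 8 List.∷ List.[])
  where import Data.List as List

-- Ind(G), for G = C₁₆(1,4,8), is pure with facets of size 4. An expansion of G is a blow-up: each
-- vertex i becomes a nonempty clique of twins. Replacing each facet, in a shelling of Ind(G) found
-- by computer, by its choices of twins in lexicographic order gives a shelling of the blow-up.
--
-- Let χ(W) be the sum of (-1)^|F| over the independent sets F contained in W. If an induced
-- subcomplex of a blow-up is vertex decomposable, W is its image in G, and r is the size of its
-- facets, then (-1)^r χ(W) ≥ 0, by induction on deletions and links; deleting a vertex that still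
-- has a twin does not change W. Were the blow-up of G vertex decomposable, some step would delete
-- the last twin over a vertex i and leave a vertex decomposable complex with W = G minus i; but
-- there r = 4 and χ = -1.

module Submission where

open import Defs
open import Data.Bool using (Bool; true; false; not; _∧_; _∨_; T; if_then_else_)
open import Data.Bool.Properties using (T-∨; T-irrelevant)
open import Data.Empty using (⊥-elim)
open import Data.Fin using (Fin; zero; suc; toℕ; fromℕ<; opposite; combine; remQuot)
open import Data.Fin.Permutation using (↔⇒≡)
open import Data.Fin.Properties
  using (_≟_; all?; toℕ<n; toℕ-fromℕ<; toℕ-injective; opposite-prop; opposite-involutive;
         toℕ-combine; combine-remQuot; remQuot-combine; combine-injectiveˡ)
open import Data.Integer as ℤ using (ℤ; 0ℤ; 1ℤ; -1ℤ; -_; _-_)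
import Data.Integer.Properties as ℤₚ
import Data.Integer.Tactic.RingSolver as ℤ-Solver
open import Data.List
  using (List; []; _∷_; _++_; map; length; lookup; filter; concatMap; cartesianProductWith; allFin; upTo)
open import Data.List.Properties
  using (length-map; map-∘; map-id-local; ∷-injective; filter-accept; filter-reject)
  renaming (≡-dec to List-≡-dec)
import Data.List.Membership.DecPropositional as DecMembership
open import Data.List.Membership.Propositional using (_∈_; _∉_; find; lose)
open import Data.List.Membership.Propositional.Properties
  using (∈-lookup; ∈-map⁺; ∈-map⁻; ∈-++⁺ˡ; ∈-++⁺ʳ; ∈-++⁻; ∈-concatMap⁺; ∈-concatMap⁻; ∈-filter⁺; ∈-filter⁻;
         ∈-cartesianProductWith⁺; ∈-cartesianProductWith⁻; ∈-allFin; ∈-upTo⁺; ∈-upTo⁻)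
open import Data.List.Relation.Unary.All as All using (All; []; _∷_)
open import Data.List.Relation.Unary.AllPairs using ([]; _∷_)
open import Data.List.Relation.Unary.Any using (Any; here; there; index; any?)
open import Data.List.Relation.Unary.Any.Properties using (lookup-index)
open import Data.List.Relation.Unary.Unique.Propositional using (Unique)
open import Data.List.Relation.Unary.Unique.Propositional.Properties
  using (Unique[x∷xs]⇒x∉xs; allFin⁺) renaming (map⁺ to Unique-map⁺)
open import Data.Nat as ℕ
  using (ℕ; zero; suc; _≤_; _<_; _+_; _*_; _∸_; _/_; _%_; ∣_-_∣; z≤n; s≤s; z<s; s<s)
open import Data.Nat.DivMod
  using (_mod_; m%n%n≡m%n; %-distribˡ-+; [m+kn]%n≡m%n; m<n⇒m%n≡m; m/n<m; m≡m%n+[m/n]*n; m%n<n)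
import Data.Nat.Properties as ℕₚ
import Data.Nat.Tactic.RingSolver as ℕ-Solver
open import Data.Product using (Σ; ∃; _×_; _,_; proj₁; proj₂; swap)
open import Data.Product.Properties using (≡-dec)
open import Data.Sum as Sum using (_⊎_; inj₁; inj₂)
open import Function.Base using (_∘_; case_of_)
open import Function.Bundles using (_↔_; _⇔_; mk⇔; mk↔ₛ′; Equivalence; Inverse; Injection)
import Function.Properties.Equivalence as ⇔
open import Function.Properties.Inverse using (↔-refl; ↔-sym; ↔-trans; Inverse⇒Injection)
open import Relation.Binary.Definitions using (DecidableEquality)
open import Relation.Binary.PropositionalEquality
open import Relation.Nullary using (¬_; Dec; yes; no; contradiction)
open import Relation.Nullary.Decidable
  using (T?; _×-dec_; _⊎-dec_; _→-dec_; ¬?; map′; toWitness; fromWitness; from-yes; ⌊_⌋)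

-- Boolean subsets and their enumerations.

T-ext : ∀ {a b} → (T a → T b) → (T b → T a) → a ≡ b
T-ext {false} {false} _ _ = refl
T-ext {false} {true}  _ g = ⊥-elim (g _)
T-ext {true}  {false} f _ = ⊥-elim (f _)
T-ext {true}  {true}  _ _ = refl

T-∧-not⁺ : ∀ {a b} → T a → ¬ T b → T (a ∧ not b)
T-∧-not⁺ {true} {false} _ _ = _
T-∧-not⁺ {true} {true}  _ ¬b = ⊥-elim (¬b _)

T-∧-not⁻ : ∀ {a b} → T (a ∧ not b) → T a × ¬ T b
T-∧-not⁻ {true} {false} _ = _ , λ ()

module _ {A : Set} where

  index-lookup : ∀ {xs : List A} → Unique xs → ∀ i (p : lookup xs i ∈ xs) → index p ≡ i
  index-lookup _        zero    (here _)   = refl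
  index-lookup u        zero    (there p)  = contradiction p (Unique[x∷xs]⇒x∉xs u)
  index-lookup u        (suc i) (here eq)  =
    contradiction (subst (_∈ _) eq (∈-lookup i)) (Unique[x∷xs]⇒x∉xs u)
  index-lookup (_ ∷ u)  (suc i) (there p)  = cong suc (index-lookup u i p)

  Σ-∋-≡ : {F : Subset A} {p q : Σ A (F ∋_)} → proj₁ p ≡ proj₁ q → p ≡ q
  Σ-∋-≡ {p = x , a} {q = _ , b} refl = cong (x ,_) (T-irrelevant a b)

  enumerates-↔ : {F : Subset A} {xs : List A} → Unique xs →
                 (∀ x → x ∈ xs → F ∋ x) → (∀ x → F ∋ x → x ∈ xs) →
                 Σ A (F ∋_) ↔ Fin (length xs)
  enumerates-↔ {F} {xs} u sound complete = mk↔ₛ′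
    (λ (x , Fx) → index (complete x Fx))
    (λ i → lookup xs i , sound _ (∈-lookup i))
    (λ i → index-lookup u i _)
    (λ (x , Fx) → Σ-∋-≡ {F = F} (sym (lookup-index (complete x Fx))))

module DecSubset {A : Set} (_≟_ : DecidableEquality A) where

  open DecMembership _≟_ using (_∈?_)

  infixl 6 _─_

  _─_ : Subset A → A → Subset A
  (W ─ x) y = W y ∧ not ⌊ x ≟ y ⌋

  ─⁺ : ∀ W {x y} → W ∋ y → x ≢ y → (W ─ x) ∋ y
  ─⁺ W {x} {y} Wy x≢y = T-∧-not⁺ Wy λ t → x≢y (toWitness t)

  ─⁻ : ∀ W {x y} → (W ─ x) ∋ y → W ∋ y × x ≢ y
  ─⁻ W {x} {y} t = let Wy , ¬eq = T-∧-not⁻ t in Wy , λ eq → ¬eq (fromWitness eq)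

  ⟦_⟧ : List A → Subset A
  ⟦ xs ⟧ y = ⌊ y ∈? xs ⌋

  ⟦⟧⁺ : ∀ {xs y} → y ∈ xs → ⟦ xs ⟧ ∋ y
  ⟦⟧⁺ = fromWitness

  ⟦⟧⁻ : ∀ {xs y} → ⟦ xs ⟧ ∋ y → y ∈ xs
  ⟦⟧⁻ = toWitness

  ⟦⟧-↔ : ∀ {xs} → Unique xs → Σ A (⟦ xs ⟧ ∋_) ↔ Fin (length xs)
  ⟦⟧-↔ u = enumerates-↔ u (λ _ → ⟦⟧⁺) (λ _ → ⟦⟧⁻)

-- Maximal independent sets of an induced subgraph.

-- c x y means "x = y or x and y are adjacent".
module Conflict {A : Set} (c : A → A → Bool)
                (c-refl : ∀ x → T (c x x)) (c-sym : ∀ {x y} → T (c x y) → T (c y x)) where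

  infixl 6 _∖N_

  _∖N_ : Subset A → A → Subset A
  (W ∖N x) y = W y ∧ not (c x y)

  ∖N⁺ : ∀ W {x y} → W ∋ y → ¬ T (c x y) → (W ∖N x) ∋ y
  ∖N⁺ W = T-∧-not⁺

  ∖N⁻ : ∀ W {x y} → (W ∖N x) ∋ y → W ∋ y × ¬ T (c x y)
  ∖N⁻ W = T-∧-not⁻

  ∖N-mono : ∀ {W W′} → W ⊆ W′ → ∀ x → (W ∖N x) ⊆ (W′ ∖N x)
  ∖N-mono {W} {W′} W⊆W′ x y t = let Wy , ¬cxy = ∖N⁻ W t in ∖N⁺ W′ (W⊆W′ y Wy) ¬cxy

  -- The lists that a greedy choice inside `W` can produce: pick a vertex, discard its closed
  -- neighbourhood, stop when nothing is left. These are the maximal independent sets of the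
  -- subgraph on `W`, each in every possible order.
  data MIS (W : Subset A) : List A → Set where
    []  : (∀ x → ¬ W ∋ x) → MIS W []
    _∷_ : ∀ {x l} → W ∋ x → MIS (W ∖N x) l → MIS W (x ∷ l)

  MIS-resp-≐ : ∀ {W W′ l} → W ≐ W′ → MIS W l → MIS W′ l
  MIS-resp-≐ (_ , W′⊆W) ([] none)   = [] λ x → none x ∘ W′⊆W x
  MIS-resp-≐ (W⊆W′ , W′⊆W) (Wx ∷ m) =
    W⊆W′ _ Wx ∷ MIS-resp-≐ (∖N-mono W⊆W′ _ , ∖N-mono W′⊆W _) m

  MIS-⊆ : ∀ {W l} → MIS W l → ∀ {x} → x ∈ l → W ∋ x
  MIS-⊆         (Wx ∷ _) (here refl) = Wx
  MIS-⊆ {W = W} (_ ∷ m)  (there x∈l) = proj₁ (∖N⁻ W (MIS-⊆ m x∈l))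

  MIS-independent : ∀ {W l} → MIS W l → ∀ {x y} → x ∈ l → y ∈ l → T (c x y) → x ≡ y
  MIS-independent (_ ∷ _) (here refl) (here refl) _ = refl
  MIS-independent {W} (_ ∷ m) (here refl) (there y∈l) cxy =
    contradiction cxy (proj₂ (∖N⁻ W (MIS-⊆ m y∈l)))
  MIS-independent {W} (_ ∷ m) (there x∈l) (here refl) cxy =
    contradiction (c-sym cxy) (proj₂ (∖N⁻ W (MIS-⊆ m x∈l)))
  MIS-independent (_ ∷ m) (there x∈l) (there y∈l) cxy = MIS-independent m x∈l y∈l cxy

  MIS-dominating : ∀ {W l} → MIS W l → ∀ {x} → W ∋ x → ∃ λ y → y ∈ l × T (c y x)
  MIS-dominating ([] none) Wx = contradiction Wx (none _)
  MIS-dominating {W} (_∷_ {y} _ m) {x} Wx with T? (c y x)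
  ... | yes cyx = y , here refl , cyx
  ... | no ¬cyx = let z , z∈l , czx = MIS-dominating m (∖N⁺ W Wx ¬cyx) in z , there z∈l , czx

  MIS-unique : ∀ {W l} → MIS W l → Unique l
  MIS-unique ([] _) = []
  MIS-unique {W} (_ ∷ m) =
    All.tabulate (λ { y∈l refl → proj₂ (∖N⁻ W (MIS-⊆ m y∈l)) (c-refl _) }) ∷ MIS-unique m

  MIS-exists : ∀ xs W → (∀ x → W ∋ x → x ∈ xs) → ∃ (MIS W)
  MIS-exists [] W sub = [] , [] λ x Wx → case sub x Wx of λ ()
  MIS-exists (x ∷ xs) W sub with T? (W x)
  ... | yes Wx =
    let l , m = MIS-exists xs (W ∖N x) λ y t → let Wy , ¬cxy = ∖N⁻ W t in
                  case sub y Wy of λ { (here refl) → contradiction (c-refl x) ¬cxy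
                                     ; (there y∈xs) → y∈xs }
    in x ∷ l , Wx ∷ m
  ... | no ¬Wx = MIS-exists xs W λ y Wy →
    case sub y Wy of λ { (here refl) → contradiction Wy ¬Wx ; (there y∈xs) → y∈xs }

-- The Euler characteristic under deletion and link.

module Euler {A : Set} (_≟_ : DecidableEquality A) (c : A → A → Bool)
             (c-refl : ∀ x → T (c x x)) (c-sym : ∀ {x y} → T (c x y) → T (c y x)) where

  open DecSubset _≟_
  open Conflict c c-refl c-sym

  -- χ xs W sums (-1)^|F| over the independent sets F ⊆ W ∩ xs, that is, minus the reduced
  -- Euler characteristic of the independence complex.
  χ : List A → Subset A → ℤ
  χ []       W = 1ℤ
  χ (x ∷ xs) W = if W x then χ xs W - χ xs (W ∖N x) else χ xs W

  χ-∋ : ∀ {W x} xs → W ∋ x → χ (x ∷ xs) W ≡ χ xs W - χ xs (W ∖N x)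
  χ-∋ {W} {x} _ Wx with true ← W x = refl

  χ-∌ : ∀ {W x} xs → ¬ W ∋ x → χ (x ∷ xs) W ≡ χ xs W
  χ-∌ {W} {x} _ ¬Wx with W x
  ... | true  = ⊥-elim (¬Wx _)
  ... | false = refl

  χ-cong : ∀ {W W′} xs → (∀ x → x ∈ xs → W x ≡ W′ x) → χ xs W ≡ χ xs W′
  χ-cong [] _ = refl
  χ-cong {W} {W′} (x ∷ xs) W≗W′ rewrite W≗W′ x (here refl)
    | χ-cong {W} {W′} xs (λ y y∈xs → W≗W′ y (there y∈xs))
    | χ-cong {W ∖N x} {W′ ∖N x} xs (λ y y∈xs → cong (_∧ not (c x y)) (W≗W′ y (there y∈xs))) = refl

  -- An independent set either avoids `x`, or is `x` together with an independent set of `W ∖N x`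
  -- and then has the opposite sign. The recursion of `χ` splits in this way only at the head of the
  -- list; the induction exchanges `x` with the head `y`.
  χ-deletion : ∀ {W x} xs → Unique xs → x ∈ xs → W ∋ x → χ xs W ≡ χ xs (W ─ x) - χ xs (W ∖N x)
  χ-deletion {W} {x} (x ∷ xs) u (here refl) Wx = trans (χ-∋ xs Wx) (cong₂ _-_
    (trans
      (χ-cong xs λ y y∈xs → T-ext
        (λ Wy → ─⁺ W Wy λ { refl → Unique[x∷xs]⇒x∉xs u y∈xs }) (proj₁ ∘ ─⁻ W))
      (sym (χ-∌ xs λ t → proj₂ (─⁻ W t) refl)))
    (sym (χ-∌ xs λ t → proj₂ (∖N⁻ W t) (c-refl x))))
  χ-deletion {W} {x} (y ∷ xs) u@(_ ∷ u′) (there x∈xs) Wx with T? (W y)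
  ... | no ¬Wy = trans (χ-∌ xs ¬Wy) (trans (χ-deletion xs u′ x∈xs Wx) (sym (cong₂ _-_
    (χ-∌ xs (¬Wy ∘ proj₁ ∘ ─⁻ W)) (χ-∌ xs (¬Wy ∘ proj₁ ∘ ∖N⁻ W)))))
  ... | yes Wy with T? (c x y)
  -- When `x` and `y` conflict, discarding the closed neighbourhood of either one discards the other
  -- too, so the term with both is absent.
  ...   | yes cxy = begin
    χ (y ∷ xs) W
      ≡⟨ χ-∋ xs Wy ⟩
    χ xs W - χ xs (W ∖N y)
      ≡⟨ cong₂ _-_ (χ-deletion xs u′ x∈xs Wx) ─∖N ⟩
    χ xs (W ─ x) - χ xs (W ∖N x) - χ xs (W ─ x ∖N y)
      ≡⟨ rearrange (χ xs (W ─ x)) (χ xs (W ∖N x)) (χ xs (W ─ x ∖N y)) ⟩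
    χ xs (W ─ x) - χ xs (W ─ x ∖N y) - χ xs (W ∖N x)
      ≡⟨ cong₂ _-_ (χ-∋ xs W─x∋y) (χ-∌ xs λ t → proj₂ (∖N⁻ W t) cxy) ⟨
    χ (y ∷ xs) (W ─ x) - χ (y ∷ xs) (W ∖N x) ∎
    where
    open ≡-Reasoning
    rearrange : ∀ a b d → a - b - d ≡ a - d - b
    rearrange = ℤ-Solver.solve-∀
    W─x∋y : (W ─ x) ∋ y
    W─x∋y = ─⁺ W Wy λ { refl → Unique[x∷xs]⇒x∉xs u x∈xs }
    ─∖N : χ xs (W ∖N y) ≡ χ xs (W ─ x ∖N y)
    ─∖N = χ-cong xs λ z _ → T-ext
      (λ t → let Wz , ¬cyz = ∖N⁻ W t in
             ∖N⁺ (W ─ x) (─⁺ W Wz λ { refl → ¬cyz (c-sym cxy) }) ¬cyz)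
      (∖N-mono {W ─ x} {W} (λ z → proj₁ ∘ ─⁻ W {x} {z}) y z)
  -- Here the operations at `x` and at `y` commute, and the four resulting terms are regrouped.
  ...   | no ¬cxy = begin
    χ (y ∷ xs) W
      ≡⟨ χ-∋ xs Wy ⟩
    χ xs W - χ xs (W ∖N y)
      ≡⟨ cong₂ _-_ (χ-deletion xs u′ x∈xs Wx)
                      (χ-deletion xs u′ x∈xs (∖N⁺ W Wx (¬cxy ∘ c-sym))) ⟩
    χ xs (W ─ x) - χ xs (W ∖N x) - (χ xs (W ∖N y ─ x) - χ xs (W ∖N y ∖N x))
      ≡⟨ cong₂ (λ a b → (χ xs (W ─ x) - χ xs (W ∖N x)) - (a - b)) ─∖N ∖N∖N ⟩
    χ xs (W ─ x) - χ xs (W ∖N x) - (χ xs (W ─ x ∖N y) - χ xs (W ∖N x ∖N y))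
      ≡⟨ rearrange (χ xs (W ─ x)) (χ xs (W ∖N x)) (χ xs (W ─ x ∖N y)) (χ xs (W ∖N x ∖N y)) ⟩
    χ xs (W ─ x) - χ xs (W ─ x ∖N y) - (χ xs (W ∖N x) - χ xs (W ∖N x ∖N y))
      ≡⟨ cong₂ _-_ (χ-∋ xs W─x∋y) (χ-∋ xs (∖N⁺ W Wy ¬cxy)) ⟨
    χ (y ∷ xs) (W ─ x) - χ (y ∷ xs) (W ∖N x) ∎
    where
    open ≡-Reasoning
    rearrange : ∀ a b d e → a - b - (d - e) ≡ a - d - (b - e)
    rearrange = ℤ-Solver.solve-∀
    W─x∋y : (W ─ x) ∋ y
    W─x∋y = ─⁺ W Wy λ { refl → Unique[x∷xs]⇒x∉xs u x∈xs }
    ─∖N : χ xs (W ∖N y ─ x) ≡ χ xs (W ─ x ∖N y)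
    ─∖N = χ-cong xs λ z _ → T-ext
      (λ t → let Wy , x≢z = ─⁻ (W ∖N y) t ; Wz , ¬cyz = ∖N⁻ W Wy in ∖N⁺ (W ─ x) (─⁺ W Wz x≢z) ¬cyz)
      (λ t → let W─z , ¬cyz = ∖N⁻ (W ─ x) t ; Wz , x≢z = ─⁻ W W─z in ─⁺ (W ∖N y) (∖N⁺ W Wz ¬cyz) x≢z)
    ∖N∖N : χ xs (W ∖N y ∖N x) ≡ χ xs (W ∖N x ∖N y)
    ∖N∖N = χ-cong xs λ z _ → T-ext (swapN {y} {x} {z}) (swapN {x} {y} {z})
      where
      swapN : ∀ {u v z} → (W ∖N u ∖N v) ∋ z → (W ∖N v ∖N u) ∋ z
      swapN {u} {v} t = let W′ , ¬v = ∖N⁻ (W ∖N u) t ; Wz , ¬u = ∖N⁻ W W′ in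
        ∖N⁺ (W ∖N v) (∖N⁺ W Wz ¬v) ¬u

  -- Multiplication by (-1)^r with r the length of the list. Reading r off a list makes the sign
  -- flip definitionally when a vertex is added.
  signed : List A → ℤ → ℤ
  signed []      z = z
  signed (_ ∷ l) z = - signed l z

  signed-cong-length : ∀ l l′ {z} → length l ≡ length l′ → signed l z ≡ signed l′ z
  signed-cong-length []      []       _  = refl
  signed-cong-length (_ ∷ l) (_ ∷ l′) eq = cong -_ (signed-cong-length l l′ (ℕₚ.suc-injective eq))

  signed-0 : ∀ l → signed l 0ℤ ≡ 0ℤ
  signed-0 []      = refl
  signed-0 (_ ∷ l) = cong -_ (signed-0 l)

  signed-- : ∀ l a b → signed l (a - b) ≡ signed l a - signed l b
  signed-- []      a b = refl
  signed-- (_ ∷ l) a b = trans (cong -_ (signed-- l a b)) (lemma (signed l a) (signed l b))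
    where
    lemma : ∀ a b → - (a - b) ≡ - a - - b
    lemma = ℤ-Solver.solve-∀

  module Enumerated (xs : List A) (xs-unique : Unique xs) (xs-complete : ∀ x → x ∈ xs) where

    -- The rank is supplied by the length of a maximal independent set. Well-coveredness is not
    -- built in, so the inequality is asked for each such set.
    EulerNonneg : Subset A → Set
    EulerNonneg W = ∀ l → MIS W l → 0ℤ ℤ.≤ signed l (χ xs W)

    WellCovered : Subset A → Set
    WellCovered W = ∀ l l′ → MIS W l → MIS W l′ → length l ≡ length l′

    -- The independence complex is a cone with apex `x`: `W ─ x` and `W ∖N x` coincide, so the two
    -- terms of the deletion formula cancel.
    χ-isolated : ∀ {W x} → W ∋ x → (∀ y → W ∋ y → T (c x y) → x ≡ y) → χ xs W ≡ 0ℤ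
    χ-isolated {W} {x} Wx isolated = trans (χ-deletion xs xs-unique (xs-complete x) Wx)
      (trans (cong (_- χ xs (W ∖N x)) (χ-cong xs λ y _ → T-ext
        (λ t → let Wy , x≢y = ─⁻ W t in ∖N⁺ W Wy (x≢y ∘ isolated y Wy))
        (λ t → let Wy , ¬cxy = ∖N⁻ W t in ─⁺ W Wy λ { refl → ¬cxy (c-refl x) })))
        (ℤₚ.+-inverseʳ (χ xs (W ∖N x))))

    χ-empty : ∀ {W} → (∀ x → ¬ W ∋ x) → ∀ ys → χ ys W ≡ 1ℤ
    χ-empty none []       = refl
    χ-empty none (y ∷ ys) = trans (χ-∌ ys (none y)) (χ-empty none ys)

    -- The complex is a full simplex. For empty `W` the only term is that of the empty set;
    -- otherwise any vertex is isolated and `χ` vanishes.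
    nonneg-edgeless : ∀ {W} → (∀ x y → W ∋ x → W ∋ y → T (c x y) → x ≡ y) → EulerNonneg W
    nonneg-edgeless _ [] ([] none) = subst (0ℤ ℤ.≤_) (sym (χ-empty none xs)) (ℤ.+≤+ ℕ.z≤n)
    nonneg-edgeless {W} edgeless l@(x ∷ _) (Wx ∷ _) =
      ℤₚ.≤-reflexive (sym (trans (cong (signed l) (χ-isolated Wx λ y → edgeless x y Wx)) (signed-0 l)))

    -- A neighbour y of x in W lies in a maximal independent set of W ─ x, which is then maximal
    -- in W; so W, W ─ x and W ∖N x have ranks r, r and r - 1.
    nonneg-shed : ∀ {W x} → WellCovered W → W ∋ x → EulerNonneg (W ─ x) → EulerNonneg (W ∖N x) →
                  EulerNonneg W
    nonneg-shed {W} {x} wc Wx del≥0 link≥0 l m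
      with any? (λ y → T? (W y) ×-dec T? (c x y) ×-dec ¬? (x ≟ y)) xs
    -- Without a neighbour in `W`, `x` is a cone point and `χ` is zero.
    ... | no none = ℤₚ.≤-reflexive (sym (trans (cong (signed l) (χ-isolated Wx isolated)) (signed-0 l)))
      where
      isolated : ∀ y → W ∋ y → T (c x y) → x ≡ y
      isolated y Wy cxy with x ≟ y
      ... | yes x≡y = x≡y
      ... | no x≢y = contradiction (lose (xs-complete y) (Wy , cxy , x≢y)) none
    ... | yes found = subst (0ℤ ℤ.≤_) (sym total) (ℤₚ.+-mono-≤ (del≥0 _ mʸ) (link≥0 _ mˣ))
      where
      y = proj₁ (find found)
      Wy = proj₁ (proj₂ (proj₂ (find found)))
      cxy = proj₁ (proj₂ (proj₂ (proj₂ (find found))))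
      x≢y = proj₂ (proj₂ (proj₂ (proj₂ (find found))))
      restˣ = MIS-exists xs (W ∖N x) λ z _ → xs-complete z
      restʸ = MIS-exists xs (W ─ x ∖N y) λ z _ → xs-complete z
      lˣ = proj₁ restˣ
      mˣ = proj₂ restˣ
      lʸ = y ∷ proj₁ restʸ
      mʸ : MIS (W ─ x) lʸ
      mʸ = ─⁺ W Wy x≢y ∷ proj₂ restʸ
      mʸ′ : MIS W lʸ
      mʸ′ = Wy ∷ MIS-resp-≐
        ( ∖N-mono {W ─ x} {W} (λ z → proj₁ ∘ ─⁻ W {x} {z}) y
        , λ z t → let Wz , ¬cyz = ∖N⁻ W t in
                  ∖N⁺ (W ─ x) (─⁺ W Wz λ { refl → ¬cyz (c-sym cxy) }) ¬cyz) (proj₂ restʸ)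
      total : signed l (χ xs W) ≡ signed lʸ (χ xs (W ─ x)) ℤ.+ signed lˣ (χ xs (W ∖N x))
      total = begin
        signed l (χ xs W)
          ≡⟨ cong (signed l) (χ-deletion xs xs-unique (xs-complete x) Wx) ⟩
        signed l (χ xs (W ─ x) - χ xs (W ∖N x))
          ≡⟨ signed-- l _ _ ⟩
        signed l (χ xs (W ─ x)) - signed l (χ xs (W ∖N x))
          ≡⟨ cong₂ _-_ (signed-cong-length l lʸ (wc _ _ m mʸ′))
                       (signed-cong-length l (x ∷ lˣ) (wc _ _ m (Wx ∷ mˣ))) ⟩
        signed lʸ (χ xs (W ─ x)) - - signed lˣ (χ xs (W ∖N x))
          ≡⟨ cong (ℤ._+_ (signed lʸ (χ xs (W ─ x)))) (ℤₚ.neg-involutive _) ⟩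
        signed lʸ (χ xs (W ─ x)) ℤ.+ signed lˣ (χ xs (W ∖N x)) ∎
        where open ≡-Reasoning

-- Shellings as lists of facets.

unique-map⇒injective : ∀ {A B : Set} (f : A → B) {xs} → Unique (map f xs) →
                       ∀ {x y} → x ∈ xs → y ∈ xs → f x ≡ f y → x ≡ y
unique-map⇒injective _ _ (here refl) (here refl) _ = refl
unique-map⇒injective f {_ ∷ xs} u (here refl) (there y∈) eq =
  contradiction (subst (_∈ map f xs) (sym eq) (∈-map⁺ f y∈)) (Unique[x∷xs]⇒x∉xs u)
unique-map⇒injective f {_ ∷ xs} u (there x∈) (here refl) eq =
  contradiction (subst (_∈ map f xs) eq (∈-map⁺ f x∈)) (Unique[x∷xs]⇒x∉xs u)
unique-map⇒injective f (_ ∷ u) (there x∈) (there y∈) eq = unique-map⇒injective f u x∈ y∈ eq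

module _ {A : Set} where

  -- The exchange condition for one pair, with `Fs` the facets that precede `F`. Together with
  -- `x ∈ F`, the last two conjuncts make `x` the only element of `F` outside `H`.
  Sheds : List A → List A → List (List A) → Set
  Sheds F G Fs = ∃ λ x → x ∈ F × x ∉ G ×
    ∃ λ H → H ∈ Fs × x ∉ H × (∀ y → y ∈ F → y ≡ x ⊎ y ∈ H)

  -- A shelling with the last facet at the head of the list.
  data ShellingList : List (List A) → Set where
    []  : ShellingList []
    _∷_ : ∀ {F Fs} → (∀ G → G ∈ Fs → Sheds F G Fs) → ShellingList Fs → ShellingList (F ∷ Fs)

  Sheds-mono : ∀ {F G Fs Fs′} → (∀ {H} → H ∈ Fs → H ∈ Fs′) → Sheds F G Fs → Sheds F G Fs′
  Sheds-mono sub (x , x∈F , x∉G , H , H∈Fs , rest) = x , x∈F , x∉G , H , sub H∈Fs , rest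

  -- Since the head of a list is the last facet, `Gs` is shelled first and `Fs` is then put on top.
  -- Exchanges within `Fs` survive the addition of further preceding facets; `cross` covers the
  -- mixed pairs.
  ShellingList-++ : ∀ {Fs Gs} → ShellingList Fs → ShellingList Gs →
                    (∀ F G → F ∈ Fs → G ∈ Gs → Sheds F G Gs) → ShellingList (Fs ++ Gs)
  ShellingList-++ [] sg cross = sg
  ShellingList-++ {F ∷ Fs} (st ∷ sf) sg cross =
    (λ G G∈ → Sum.[ Sheds-mono ∈-++⁺ˡ ∘ st G , Sheds-mono (∈-++⁺ʳ Fs) ∘ cross F G (here refl) ]
                (∈-++⁻ Fs G∈))
    ∷ ShellingList-++ sf sg (λ F G → cross F G ∘ there)

  -- Coning with a new apex `v` keeps every exchange: the exchanged `x` lies in `F`, hence differs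
  -- from `v`.
  ShellingList-map-∷ : ∀ {v Fs} → (∀ F → F ∈ Fs → v ∉ F) → ShellingList Fs →
                       ShellingList (map (v ∷_) Fs)
  ShellingList-map-∷ _ [] = []
  ShellingList-map-∷ {v} {F ∷ Fs} v∉ (st ∷ sf) =
    (λ G G∈ → case ∈-map⁻ (v ∷_) G∈ of λ { (G₀ , G₀∈ , refl) → cone (st G₀ G₀∈) })
    ∷ ShellingList-map-∷ (λ G → v∉ G ∘ there) sf
    where
    cone : ∀ {G} → Sheds F G Fs → Sheds (v ∷ F) (v ∷ G) (map (v ∷_) Fs)
    cone (x , x∈F , x∉G , H , H∈ , x∉H , F⊆) =
      x , there x∈F , x∉v∷ x∉G , v ∷ H , ∈-map⁺ (v ∷_) H∈ , x∉v∷ x∉H ,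
      λ { _ (here refl) → inj₂ (here refl) ; y (there y∈F) → Sum.map₂ there (F⊆ y y∈F) }
      where
      x∉v∷ : ∀ {G} → x ∉ G → x ∉ (v ∷ G)
      x∉v∷ x∉G (here refl) = v∉ F (here refl) x∈F
      x∉v∷ x∉G (there x∈G) = x∉G x∈G

  -- The join of a discrete set of points with a shelled complex, in lexicographic order: one cone
  -- over `Fs` for each point.
  ShellingList-join : ∀ {vs Fs} → Unique vs → (∀ v F → v ∈ vs → F ∈ Fs → v ∉ F) →
                      ShellingList Fs → ShellingList (cartesianProductWith _∷_ vs Fs)
  ShellingList-join {[]} _ _ _ = []
  ShellingList-join {v ∷ vs} {Fs} u@(_ ∷ u′) v∉ sf = ShellingList-++
    (ShellingList-map-∷ (λ F → v∉ v F (here refl)) sf)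
    (ShellingList-join u′ (λ w F → v∉ w F ∘ there) sf)
    λ F G F∈ G∈ → case (∈-map⁻ (v ∷_) F∈ , ∈-cartesianProductWith⁻ _∷_ vs Fs G∈) of
      -- Between two cones the apex itself is exchanged: `w ∷ F₀` belongs to the earlier cone and
      -- lacks only `v` from `v ∷ F₀`.
      λ { ((F₀ , F₀∈ , refl) , (w , G₀ , w∈ , G₀∈ , refl)) →
        let v∉w∷ : ∀ {G} → G ∈ Fs → v ∉ (w ∷ G)
            v∉w∷ G∈ = λ { (here refl) → Unique[x∷xs]⇒x∉xs u w∈
                        ; (there v∈G) → v∉ v _ (here refl) G∈ v∈G }
        in v , here refl , v∉w∷ G₀∈ , w ∷ F₀ , ∈-cartesianProductWith⁺ _∷_ w∈ F₀∈ , v∉w∷ F₀∈ ,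
           λ { _ (here refl) → inj₁ refl ; y (there y∈F) → inj₂ (there y∈F) } }

  ShellingList-lookup : ∀ {Fs} → ShellingList Fs → ∀ i j → toℕ i < toℕ j →
    ∃ λ x → x ∈ lookup Fs i × x ∉ lookup Fs j ×
    ∃ λ k → toℕ i < toℕ k × x ∉ lookup Fs k × (∀ y → y ∈ lookup Fs i → y ≡ x ⊎ y ∈ lookup Fs k)
  ShellingList-lookup {F ∷ Fs} (st ∷ _) zero (suc j) _ =
    let x , x∈F , x∉G , H , H∈ , x∉H , F⊆ = st (lookup Fs j) (∈-lookup j)
        H≡ = lookup-index H∈
    in x , x∈F , x∉G , suc (index H∈) , z<s , subst (x ∉_) H≡ x∉H ,
       λ y y∈F → Sum.map₂ (subst (y ∈_) H≡) (F⊆ y y∈F)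
  ShellingList-lookup (_ ∷ sf) (suc i) (suc j) (s<s i<j) =
    let x , x∈F , x∉G , k , i<k , rest = ShellingList-lookup sf i j i<j
    in x , x∈F , x∉G , suc k , s<s i<k , rest

  module _ (_≟_ : DecidableEquality A) where

    open DecMembership _≟_ using (_∈?_)

    -- The vertices of `F` that pass form what is called the restriction of `F` in a shelling; `F`
    -- may be added exactly when no earlier facet contains all of it.
    removable? : ∀ F Fs x → Dec (Any (λ H → x ∉ H × All (λ y → y ≡ x ⊎ y ∈ H) F) Fs)
    removable? F Fs x = any? (λ H → ¬? (x ∈? H) ×-dec All.all? (λ y → (y ≟ x) ⊎-dec (y ∈? H)) F) Fs

    -- The removable elements of F are computed once and then compared with every earlier G.
    sheds? : ∀ F Fs → Dec (∀ G → G ∈ Fs → Sheds F G Fs)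
    sheds? F Fs = map′ fromAll toAll (leaves (filter (removable? F Fs) F))
      where
      leaves : ∀ R → Dec (All (λ G → Any (_∉ G) R) Fs)
      leaves R = All.all? (λ G → any? (λ x → ¬? (x ∈? G)) R) Fs
      fromAll : All (λ G → Any (_∉ G) (filter (removable? F Fs) F)) Fs → ∀ G → G ∈ Fs → Sheds F G Fs
      fromAll p G G∈ =
        let x , x∈R , x∉G = find (All.lookup p G∈)
            x∈F , q = ∈-filter⁻ (removable? F Fs) {xs = F} x∈R
            H , H∈ , x∉H , F⊆ = find q
        in x , x∈F , x∉G , H , H∈ , x∉H , λ y → All.lookup F⊆
      toAll : (∀ G → G ∈ Fs → Sheds F G Fs) → All (λ G → Any (_∉ G) (filter (removable? F Fs) F)) Fs
      toAll st = All.tabulate λ {G} G∈ →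
        let x , x∈F , x∉G , H , H∈ , x∉H , F⊆ = st G G∈
        in lose (∈-filter⁺ (removable? F Fs) x∈F (lose H∈ (x∉H , All.tabulate λ {y} → F⊆ y))) x∉G

    shellingList? : ∀ Fs → Dec (ShellingList Fs)
    shellingList? [] = yes []
    shellingList? (F ∷ Fs) = map′ (λ (st , sf) → st ∷ sf) (λ { (st ∷ sf) → st , sf })
                                  (sheds? F Fs ×-dec shellingList? Fs)

    open DecSubset _≟_

    -- `opposite` turns the list, whose head is the last facet, into an increasing enumeration.
    shelling : ∀ {Δ Fs} → ShellingList Fs → (∀ F → F ∈ Fs → Facet Δ ⟦ F ⟧) →
               (∀ F → Facet Δ F → ∃ λ E → E ∈ Fs × ⟦ E ⟧ ≐ F) →
               Shelling Δ (length Fs) λ i → ⟦ lookup Fs (opposite i) ⟧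
    shelling {Fs = Fs} sf facets complete =
      (λ i → facets _ (∈-lookup (opposite i))) ,
      (λ F facet → let E , E∈ , E≐F = complete F facet in
        opposite (index E∈) ,
        subst (λ E → ⟦ E ⟧ ≐ F)
          (trans (lookup-index E∈) (cong (lookup Fs) (sym (opposite-involutive (index E∈))))) E≐F) ,
      λ i j j<i →
        let x , x∈ , x∉ , k , i<k , x∉k , F⊆ =
              ShellingList-lookup sf (opposite i) (opposite j) (opposite-< j<i)
            k≡ = sym (opposite-involutive k)
        in x , ⟦⟧⁺ x∈ , x∉ ∘ ⟦⟧⁻ , opposite k ,
           subst (toℕ (opposite k) <_) (cong toℕ (opposite-involutive i)) (opposite-< i<k) ,
           λ y → mk⇔
             (λ (y∈ , y∉k) → case F⊆ y (⟦⟧⁻ y∈) of λ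
               { (inj₁ y≡x) → y≡x
               ; (inj₂ y∈k) → contradiction (⟦⟧⁺ (subst (λ k → y ∈ lookup Fs k) k≡ y∈k)) y∉k })
             λ { refl → ⟦⟧⁺ x∈ , x∉k ∘ subst (λ k → y ∈ lookup Fs k) (sym k≡) ∘ ⟦⟧⁻ }
      where
      opposite-< : ∀ {n} {i j : Fin n} → toℕ j < toℕ i → toℕ (opposite i) < toℕ (opposite j)
      opposite-< {n} {i} {j} j<i = subst₂ _<_ (sym (opposite-prop i)) (sym (opposite-prop j))
        (ℕₚ.∸-monoʳ-< (s<s j<i) (toℕ<n i))

-- Blow-ups of a finite graph.

module BlowupTheory
  {A : Set} (_≟_ : DecidableEquality A) (c : A → A → Bool)
  (c-refl : ∀ x → T (c x x)) (c-sym : ∀ {x y} → T (c x y) → T (c y x))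
  (xs : List A) (xs-unique : Unique xs) (xs-complete : ∀ x → x ∈ xs) where

  -- H is an expansion, with nonempty finite fibres, of the graph on A with closed adjacency c.
  record Blowup (H : Graph) : Set where
    field
      _≟ᵥ_         : DecidableEquality (V H)
      π            : V H → A
      fibre        : A → List (V H)
      fibre-unique : ∀ i → Unique (fibre i)
      ∈-fibre      : ∀ v → v ∈ fibre (π v)
      π-fibre      : ∀ {i v} → v ∈ fibre i → π v ≡ i
      rep          : A → V H
      π-rep        : ∀ i → π (rep i) ≡ i
      Adj⁻         : ∀ {v w} → Adj H v w → v ≢ w × T (c (π v) (π w))
      Adj⁺         : ∀ {v w} → v ≢ w → T (c (π v) (π w)) → Adj H v w

  open DecSubset _≟_ using (_─_; ─⁺; ─⁻) public
  open Conflict c c-refl c-sym public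
  open Euler _≟_ c c-refl c-sym public
  open Enumerated xs xs-unique xs-complete public

  all-A : Subset A
  all-A _ = true

  mis? : ∀ W l → Dec (MIS W l)
  mis? W [] = map′ (λ none → [] λ x → All.lookup none (xs-complete x))
                   (λ { ([] none) → All.tabulate λ {x} _ → none x })
                   (All.all? (λ x → ¬? (T? (W x))) xs)
  mis? W (x ∷ l) = map′ (λ (Wx , m) → Wx ∷ m) (λ { (Wx ∷ m) → Wx , m })
                        (T? (W x) ×-dec mis? (W ∖N x) l)

  record Maximal (M : Subset A) : Set where
    field
      independent : ∀ i j → M ∋ i → M ∋ j → T (c i j) → i ≡ j
      dominating  : ∀ i → ∃ λ j → M ∋ j × T (c j i)

  -- The branching is that of `χ`, and each set is listed in the order of the vertex list, so that
  -- it can be compared with a `filter` of that list.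
  independents : List A → Subset A → List (List A)
  independents []       W = [] ∷ []
  independents (y ∷ ys) W =
    independents ys W ++ (if W y then map (y ∷_) (independents ys (W ∖N y)) else [])

  ∈-independents : ∀ {M} → (∀ i j → M ∋ i → M ∋ j → T (c i j) → i ≡ j) →
                   ∀ ys → Unique ys → ∀ W → (∀ i → i ∈ ys → M ∋ i → W ∋ i) →
                   filter (T? ∘ M) ys ∈ independents ys W
  ∈-independents ind [] _ _ _ = here refl
  ∈-independents {M} ind (y ∷ ys) u@(_ ∷ u′) W sub with T? (M y)
  ... | no ¬My rewrite filter-reject (T? ∘ M) {xs = ys} ¬My =
    ∈-++⁺ˡ (∈-independents ind ys u′ W λ i → sub i ∘ there)
  ... | yes My rewrite filter-accept (T? ∘ M) {xs = ys} My with W y | sub y (here refl) My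
  ...   | true | _ = ∈-++⁺ʳ (independents ys W) (∈-map⁺ (y ∷_)
    (∈-independents ind ys u′ (W ∖N y) λ i i∈ys Mi → ∖N⁺ W (sub i (there i∈ys) Mi) λ cyi →
      Unique[x∷xs]⇒x∉xs u (subst (_∈ ys) (sym (ind y i My Mi cyi)) i∈ys)))

  -- A decidable form of completeness: an independent set either can be enlarged by some `i` or is
  -- one of `facets`. A maximal set is excluded from the first alternative by domination.
  Listed : List (List A) → Set
  Listed facets = All (λ l → Any (λ i → All (λ j → ¬ T (c j i)) l) xs ⊎ l ∈ facets)
                      (independents xs all-A)

  listed? : ∀ facets → Dec (Listed facets)
  listed? facets =
    All.all? (λ l → any? (λ i → All.all? (λ j → ¬? (T? (c j i))) l) xs ⊎-dec (l ∈? facets)) _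
    where
    open DecMembership (List-≡-dec _≟_) using (_∈?_)

  maximal⇒∈ : ∀ {facets} → Listed facets → ∀ {M} → Maximal M → filter (T? ∘ M) xs ∈ facets
  maximal⇒∈ listed {M} max
    with All.lookup listed (∈-independents (Maximal.independent max) xs xs-unique all-A _)
  ... | inj₂ l∈ = l∈
  ... | inj₁ free =
    let i , _ , ¬c = find free
        j , Mj , cji = Maximal.dominating max i
    in contradiction cji (All.lookup ¬c (∈-filter⁺ (T? ∘ M) (xs-complete j) Mj))

  -- Adjacency in a blow-up depends only on distinctness and on the images under `π`, so a bijection
  -- compatible with the projections preserves it.
  blowup-≅ : ∀ {H H′} (B : Blowup H) (B′ : Blowup H′) (f : V H ↔ V H′) →
             (∀ v → Blowup.π B′ (Inverse.to f v) ≡ Blowup.π B v) → H ≅ H′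
  blowup-≅ B B′ f π-f = f , λ v w → mk⇔
    (λ adj → let v≢w , cvw = Blowup.Adj⁻ B adj in
      Blowup.Adj⁺ B′ (v≢w ∘ Injection.injective (Inverse⇒Injection f))
        (subst₂ (λ i j → T (c i j)) (sym (π-f v)) (sym (π-f w)) cvw))
    (λ adj → let fv≢fw , cvw = Blowup.Adj⁻ B′ adj in
      Blowup.Adj⁺ B (fv≢fw ∘ cong (Inverse.to f))
        (subst₂ (λ i j → T (c i j)) (π-f v) (π-f w) cvw))

  -- Vertex decomposability of a blow-up and its shadow in the base graph.

  module _ {H : Graph} (B : Blowup H) where

    open Blowup B
    open DecSubset _≟ᵥ_ using (⟦_⟧; ⟦⟧⁺; ⟦⟧⁻; ⟦⟧-↔) renaming (_─_ to _─ᵥ_; ─⁺ to ─ᵥ⁺; ─⁻ to ─ᵥ⁻)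
    open Conflict (λ v w → c (π v) (π w)) (c-refl ∘ π) c-sym using () renaming
      (_∖N_ to _∖Nᵥ_; ∖N⁺ to ∖Nᵥ⁺; ∖N⁻ to ∖Nᵥ⁻; MIS to MISᵥ; [] to []ᵥ; _∷_ to _∷ᵥ_;
       MIS-independent to MISᵥ-independent; MIS-dominating to MISᵥ-dominating;
       MIS-unique to MISᵥ-unique)

    -- The induced subcomplex on `U`, given only up to logical equivalence of faces, because `del`
    -- and `link` yield complexes that agree with induced ones only in this sense.
    Restricts : Complex (V H) → Subset (V H) → Set
    Restricts Δ U = ∀ F → Δ F ⇔ (Ind H F × F ⊆ U)

    Shadow : Subset (V H) → Subset A → Set
    Shadow U W = (∀ v → U ∋ v → W ∋ π v) × (∀ i → W ∋ i → ∃ λ v → U ∋ v × π v ≡ i)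

    -- Maximality is domination: every vertex of `U` is equal or adjacent to a member of `E`, so an
    -- independent set containing `E` has nothing to add.
    MIS-facet : ∀ {Δ U E} → Restricts Δ U → MISᵥ U E → Facet Δ ⟦ E ⟧
    MIS-facet {Δ} {U} {E} r m =
      Equivalence.from (r _)
        ( (λ v w Ev Ew adj → let v≢w , cvw = Adj⁻ adj in
             v≢w (MISᵥ-independent m (⟦⟧⁻ Ev) (⟦⟧⁻ Ew) cvw))
        , (λ v Ev → MISᵥ-⊆ m (⟦⟧⁻ Ev)) ) ,
      maximal
      where
      open Conflict (λ v w → c (π v) (π w)) (c-refl ∘ π) c-sym using () renaming (MIS-⊆ to MISᵥ-⊆)
      maximal : ∀ G → Δ G → ⟦ E ⟧ ⊆ G → G ⊆ ⟦ E ⟧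
      maximal G ΔG E⊆G v Gv =
        let ind , G⊆U = Equivalence.to (r G) ΔG
            w , w∈E , cwv = MISᵥ-dominating m (G⊆U v Gv)
        in case w ≟ᵥ v of λ
          { (yes w≡v) → subst (⟦ E ⟧ ∋_) w≡v (⟦⟧⁺ w∈E)
          ; (no w≢v)  → contradiction (Adj⁺ w≢v cwv) (ind w v (E⊆G w (⟦⟧⁺ w∈E)) Gv) }

    -- A closed neighbourhood upstairs is the full preimage of one downstairs, twins included. A
    -- greedy choice in `U` therefore projects step by step to one in `W`.
    shadow-∖N : ∀ {U W} → Shadow U W → ∀ v → Shadow (U ∖Nᵥ v) (W ∖N π v)
    shadow-∖N {U} {W} (down , up) v =
      (λ w t → let Uw , ¬c = ∖Nᵥ⁻ U t in ∖N⁺ W (down w Uw) ¬c) ,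
      λ i t → let Wi , ¬c = ∖N⁻ W t in
        case up i Wi of λ { (w , Uw , refl) → w , ∖Nᵥ⁺ U Uw ¬c , refl }

    lift-MIS : ∀ {U W l} → Shadow U W → MIS W l → ∀ E → map π E ≡ l → (∀ {v} → v ∈ E → U ∋ v) →
               MISᵥ U E
    lift-MIS (down , _) ([] none) [] refl _ = []ᵥ λ v → none (π v) ∘ down v
    lift-MIS {U} {W} sh (_ ∷ m) (v ∷ E) refl E⊆U = E⊆U (here refl) ∷ᵥ
      lift-MIS (shadow-∖N sh v) m E refl λ w∈E →
        ∖Nᵥ⁺ U (E⊆U (there w∈E)) (proj₂ (∖N⁻ W (MIS-⊆ m (∈-map⁺ π w∈E))))

    section : ∀ {U} l → (∀ {i} → i ∈ l → ∃ λ v → U ∋ v × π v ≡ i) →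
              ∃ λ E → map π E ≡ l × (∀ {v} → v ∈ E → U ∋ v)
    section [] _ = [] , refl , λ ()
    section (i ∷ l) up =
      let v , Uv , πv≡i = up (here refl)
          E , πE≡l , E⊆U = section l (up ∘ there)
      in v ∷ E , cong₂ _∷_ πv≡i πE≡l , λ { (here refl) → Uv ; (there w∈E) → E⊆U w∈E }

    lift : ∀ {U W l} → Shadow U W → MIS W l → ∃ λ E → map π E ≡ l × MISᵥ U E
    lift sh m =
      let E , πE≡l , E⊆U = section _ (proj₂ sh _ ∘ MIS-⊆ m)
      in E , πE≡l , lift-MIS sh m E πE≡l E⊆U

    -- Maximal independent sets of `W` lift to facets with the same number of vertices, and purity
    -- equates those numbers.
    pure⇒wellCovered : ∀ {Δ U W} → Pure Δ → Restricts Δ U → Shadow U W →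
                       WellCovered W
    pure⇒wellCovered pure r sh l l′ m m′ with lift sh m | lift sh m′
    ... | E , refl , mE | E′ , refl , mE′ = begin
      length (map π E)  ≡⟨ length-map π E ⟩
      length E          ≡⟨ ↔⇒≡ (↔-trans (↔-sym (⟦⟧-↔ (MISᵥ-unique mE)))
                             (↔-trans (pure _ _ (MIS-facet r mE) (MIS-facet r mE′))
                                      (⟦⟧-↔ (MISᵥ-unique mE′)))) ⟩
      length E′         ≡⟨ length-map π E′ ⟨
      length (map π E′) ∎
      where open ≡-Reasoning

    -- Each `i` in `W` begins a greedy choice, whose lift must be the unique facet `F`. So `F` meets
    -- every fibre over `W`, and an edge of `W` would give an edge inside `F`.
    uniqueFacet⇒edgeless : ∀ {Δ U W} → UniqueFacet Δ → Restricts Δ U → Shadow U W →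
                           ∀ i j → W ∋ i → W ∋ j → T (c i j) → i ≡ j
    uniqueFacet⇒edgeless {U = U} {W} (F , (ΔF , _) , unique) r sh i j Wi Wj cij with i ≟ j
    ... | yes i≡j = i≡j
    ... | no i≢j = case (meets i Wi , meets j Wj) of λ
      { ((v , Fv , refl) , (w , Fw , refl)) →
        contradiction (Adj⁺ (λ { refl → i≢j refl }) cij) (proj₁ (Equivalence.to (r F) ΔF) v w Fv Fw) }
      where
      meets : ∀ i → W ∋ i → ∃ λ v → F ∋ v × π v ≡ i
      meets i Wi with MIS-exists xs (W ∖N i) (λ x _ → xs-complete x)
      ... | l , m with lift sh (Wi ∷ m)
      ...   | v ∷ E , πE≡ , mE =
        v , proj₁ (unique _ (MIS-facet r mE)) v (⟦⟧⁺ (here refl)) , proj₁ (∷-injective πE≡)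

    restricts-del : ∀ {Δ U} → Restricts Δ U → ∀ x → Restricts (del Δ x) (U ─ᵥ x)
    restricts-del {U = U} r x F = mk⇔
      (λ (ΔF , ¬Fx) → let ind , F⊆U = Equivalence.to (r F) ΔF in
        ind , λ v Fv → ─ᵥ⁺ U (F⊆U v Fv) λ { refl → ¬Fx Fv })
      (λ (ind , F⊆) → Equivalence.from (r F) (ind , λ v Fv → proj₁ (─ᵥ⁻ U (F⊆ v Fv))) ,
        λ Fx → proj₂ (─ᵥ⁻ U (F⊆ x Fx)) refl)

    restricts-link : ∀ {Δ U x} → U ∋ x → Restricts Δ U → Restricts (link Δ x) (U ∖Nᵥ x)
    restricts-link {Δ} {U} {x} Ux r F = mk⇔
      (λ (ΔF , ¬Fx , G , ΔG , G⇔) →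
        let ind , F⊆U = Equivalence.to (r F) ΔF
            indG , _  = Equivalence.to (r G) ΔG
        in ind , λ v Fv → ∖Nᵥ⁺ U (F⊆U v Fv) λ cxv →
             indG x v (Equivalence.from (G⇔ x) (inj₂ refl)) (Equivalence.from (G⇔ v) (inj₁ Fv))
               (Adj⁺ (λ { refl → ¬Fx Fv }) cxv))
      (λ (ind , F⊆) →
        Equivalence.from (r F) (ind , λ v Fv → proj₁ (∖Nᵥ⁻ U (F⊆ v Fv))) ,
        (λ Fx → proj₂ (∖Nᵥ⁻ U (F⊆ x Fx)) (c-refl _)) ,
        F∪x , Equivalence.from (r F∪x)
          ( (λ v w Gv Gw adj → let v≢w , cvw = Adj⁻ adj in
              case (Equivalence.to (F∪x⇔ v) Gv , Equivalence.to (F∪x⇔ w) Gw) of λ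
                { (inj₁ Fv   , inj₁ Fw)   → ind v w Fv Fw adj
                ; (inj₁ Fv   , inj₂ refl) → proj₂ (∖Nᵥ⁻ U (F⊆ v Fv)) (c-sym cvw)
                ; (inj₂ refl , inj₁ Fw)   → proj₂ (∖Nᵥ⁻ U (F⊆ w Fw)) cvw
                ; (inj₂ refl , inj₂ refl) → v≢w refl })
          , (λ v Gv → case Equivalence.to (F∪x⇔ v) Gv of λ
                { (inj₁ Fv) → proj₁ (∖Nᵥ⁻ U (F⊆ v Fv)) ; (inj₂ refl) → Ux })) ,
        F∪x⇔)
      where
      F∪x : Subset (V H)
      F∪x v = F v ∨ ⌊ v ≟ᵥ x ⌋
      F∪x⇔ : ∀ v → (F∪x ∋ v) ⇔ ((F ∋ v) ⊎ v ≡ x)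
      F∪x⇔ v = mk⇔ (Sum.map₂ toWitness ∘ Equivalence.to T-∨)
                   (Equivalence.from T-∨ ∘ Sum.map₂ fromWitness)

    -- Removing x leaves the shadow unchanged while a twin of x remains.
    shadow-─ : ∀ {U W} → Shadow U W → ∀ x →
               Shadow (U ─ᵥ x) W ⊎ Shadow (U ─ᵥ x) (W ─ π x)
    shadow-─ {U} {W} (down , up) x with any? (λ v → T? ((U ─ᵥ x) v)) (fibre (π x))
    ... | yes twin = inj₁ ((λ v → down v ∘ proj₁ ∘ ─ᵥ⁻ U) , up′)
      where
      up′ : ∀ i → W ∋ i → ∃ λ v → (U ─ᵥ x) ∋ v × π v ≡ i
      up′ i Wi with up i Wi
      ... | v , Uv , refl with x ≟ᵥ v
      ...   | no x≢v   = v , ─ᵥ⁺ U Uv x≢v , refl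
      ...   | yes refl = let w , w∈ , Uw = find twin in w , Uw , π-fibre w∈
    ... | no none = inj₂
      ( (λ v t → let Uv , _ = ─ᵥ⁻ U t in ─⁺ W (down v Uv) λ πx≡πv →
          none (lose (subst (λ i → v ∈ fibre i) (sym πx≡πv) (∈-fibre v)) t))
      , λ i t → let Wi , πx≢i = ─⁻ W t ; v , Uv , πv≡i = up i Wi in
          v , ─ᵥ⁺ U Uv (λ x≡v → πx≢i (trans (cong π x≡v) πv≡i)) , πv≡i )

    vertex∈ : ∀ {Δ U x} → Restricts Δ U → IsVertex Δ x → U ∋ x
    vertex∈ {x = x} r (G , ΔG , G⇔) =
      proj₂ (Equivalence.to (r G) ΔG) x (Equivalence.from (G⇔ x) refl)

    VD⇒eulerNonneg : ∀ {Δ U W} → VertexDecomposable Δ → Restricts Δ U → Shadow U W →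
                     EulerNonneg W
    VD⇒eulerNonneg (simplex _ unique) r sh =
      nonneg-edgeless (uniqueFacet⇒edgeless unique r sh)
    VD⇒eulerNonneg (decomp pure x vertex vd-del vd-link) r sh with shadow-─ sh x
    ... | inj₁ sh′ = VD⇒eulerNonneg vd-del (restricts-del r x) sh′
    -- The last twin disappears: the shadows of the deletion and of the link are the two sets that
    -- `nonneg-shed` compares, and purity of `Δ` makes `W` well covered.
    ... | inj₂ sh′ = nonneg-shed (pure⇒wellCovered pure r sh)
      (proj₁ sh x (vertex∈ r vertex))
      (VD⇒eulerNonneg vd-del (restricts-del r x) sh′)
      (VD⇒eulerNonneg vd-link (restricts-link (vertex∈ r vertex) r) (shadow-∖N sh x))

    module _ {i j : A} (i≢j : i ≢ j) (cij : T (c i j))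
             (obstruction : ∀ x → ¬ EulerNonneg (all-A ─ x)) where

      -- The derivation is followed along deletions as long as the shadow is the whole base. The
      -- edge between `i` and `j` prevents it from ending at a simplex, and the first deletion to
      -- shrink the shadow meets `obstruction`.
      ¬VD-shadow : ∀ {Δ U} → Restricts Δ U → Shadow U all-A → ¬ VertexDecomposable Δ
      ¬VD-shadow r sh (simplex _ unique) = i≢j (uniqueFacet⇒edgeless unique r sh i j _ _ cij)
      ¬VD-shadow r sh (decomp _ x _ vd-del _) with shadow-─ sh x
      ... | inj₁ sh′ = ¬VD-shadow (restricts-del r x) sh′ vd-del
      ... | inj₂ sh′ = obstruction (π x) (VD⇒eulerNonneg vd-del (restricts-del r x) sh′)

    restricts-all : Restricts (Ind H) (λ _ → true)
    restricts-all F = mk⇔ (λ ind → ind , λ _ _ → _) proj₁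

    shadow-all : Shadow (λ _ → true) all-A
    shadow-all = (λ _ _ → _) , λ i _ → rep i , _ , π-rep i

    ¬VD : ∀ {i j} → i ≢ j → T (c i j) → (∀ x → ¬ EulerNonneg (all-A ─ x)) →
          ¬ VertexDecomposable (Ind H)
    ¬VD i≢j cij obstruction = ¬VD-shadow i≢j cij obstruction restricts-all shadow-all

    -- Lifting a shelling to a blow-up.

    choices : List A → List (List (V H))
    choices []      = [] ∷ []
    choices (i ∷ l) = cartesianProductWith _∷_ (fibre i) (choices l)

    ∈-choices⁺ : ∀ E → E ∈ choices (map π E)
    ∈-choices⁺ []      = here refl
    ∈-choices⁺ (v ∷ E) = ∈-cartesianProductWith⁺ _∷_ (∈-fibre v) (∈-choices⁺ E)

    ∈-choices⁻ : ∀ {E} l → E ∈ choices l → map π E ≡ l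
    ∈-choices⁻ [] (here refl) = refl
    ∈-choices⁻ (i ∷ l) E∈ with ∈-cartesianProductWith⁻ _∷_ (fibre i) (choices l) E∈
    ... | v , E , v∈ , E∈ , refl = cong₂ _∷_ (π-fibre v∈) (∈-choices⁻ l E∈)

    -- The choices of twins over `l` are the facets of an iterated join of the fibres, each a
    -- discrete set of points.
    choices-shelling : ∀ {l} → Unique l → ShellingList (choices l)
    choices-shelling {[]} _ = (λ _ ()) ∷ []
    choices-shelling {i ∷ l} u@(_ ∷ u′) = ShellingList-join (fibre-unique i)
      (λ v F v∈ F∈ v∈F → Unique[x∷xs]⇒x∉xs u
        (subst₂ _∈_ (π-fibre v∈) (∈-choices⁻ l F∈) (∈-map⁺ π v∈F)))
      (choices-shelling u′)

    -- The exchanged vertex is the `v` in `F` over `x`. The earlier facet is a lift of `h` that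
    -- agrees with `F` over their common image, so that `F` loses no vertex except `v`.
    lift-sheds : ∀ {l F G ls} → Unique l → Sheds l (map π G) ls → map π F ≡ l →
                 Sheds F G (concatMap choices ls)
    lift-sheds {F = F} {G} {ls} u (x , x∈l , x∉k , h , h∈ , x∉h , l⊆) refl
      with ∈-map⁻ π x∈l
    ... | v , v∈F , refl =
      v , v∈F , x∉k ∘ ∈-map⁺ π , map pick h ,
      ∈-concatMap⁺ choices
        (lose h∈ (subst (λ k → map pick h ∈ choices k) π-pick-h (∈-choices⁺ (map pick h)))) ,
      (λ v∈ → x∉h (subst (π v ∈_) π-pick-h (∈-map⁺ π v∈))) ,
      λ w w∈F → case l⊆ (π w) (∈-map⁺ π w∈F) of λ
        { (inj₁ eq)  → inj₁ (unique-map⇒injective π u w∈F v∈F eq)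
        ; (inj₂ πw∈h) → inj₂ (subst (_∈ map pick h) (pick-F w∈F) (∈-map⁺ pick πw∈h)) }
      where
      -- The twin used by `F` where there is one, and the default `rep i` over the other vertices.
      pick : A → V H
      pick i with any? (λ w → π w ≟ i) F
      ... | yes w = proj₁ (find w)
      ... | no _  = rep i
      π-pick : ∀ i → π (pick i) ≡ i
      π-pick i with any? (λ w → π w ≟ i) F
      ... | yes w = proj₂ (proj₂ (find w))
      ... | no _  = π-rep i
      pick-F : ∀ {w} → w ∈ F → pick (π w) ≡ w
      pick-F {w} w∈F with any? (λ w′ → π w′ ≟ π w) F
      ... | yes p = unique-map⇒injective π u (proj₁ (proj₂ (find p))) w∈F (proj₂ (proj₂ (find p)))
      ... | no none = contradiction (lose w∈F refl) none
      π-pick-h : map π (map pick h) ≡ h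
      π-pick-h = trans (sym (map-∘ h)) (map-id-local (All.tabulate λ {i} _ → π-pick i))

    lift-shelling : ∀ {ls} → (∀ {l} → l ∈ ls → Unique l) → ShellingList ls →
                    ShellingList (concatMap choices ls)
    lift-shelling _ [] = []
    lift-shelling {l ∷ ls} u (st ∷ sl) = ShellingList-++ (choices-shelling (u (here refl)))
      (lift-shelling (u ∘ there) sl)
      λ F G F∈ G∈ → let k , k∈ , G∈k = find (∈-concatMap⁻ choices {ls} G∈) in
        lift-sheds (u (here refl))
          (subst (λ k → Sheds l k ls) (sym (∈-choices⁻ k G∈k)) (st k k∈)) (∈-choices⁻ l F∈)

    facet⇒maximal : ∀ {F} → Facet (Ind H) F → ∃ λ M → Maximal M × Shadow F M
    facet⇒maximal {F} (ind , max) = M , record { independent = independent ; dominating = dominating } ,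
      down , up
      where
      M : Subset A
      M i = ⌊ any? (λ v → T? (F v)) (fibre i) ⌋
      down : ∀ v → F ∋ v → M ∋ π v
      down v Fv = fromWitness (lose (∈-fibre v) Fv)
      up : ∀ i → M ∋ i → ∃ λ v → F ∋ v × π v ≡ i
      up i Mi = let v , v∈ , Fv = find (toWitness Mi) in v , Fv , π-fibre v∈
      independent : ∀ i j → M ∋ i → M ∋ j → T (c i j) → i ≡ j
      independent i j Mi Mj cij with up i Mi | up j Mj
      ... | v , Fv , refl | w , Fw , refl with v ≟ᵥ w
      ...   | yes refl = refl
      ...   | no v≢w = contradiction (Adj⁺ v≢w cij) (ind v w Fv Fw)
      dominating : ∀ i → ∃ λ j → M ∋ j × T (c j i)
      dominating i with any? (λ j → T? (M j) ×-dec T? (c j i)) xs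
      ... | yes p = let j , _ , Mj , cji = find p in j , Mj , cji
      -- If nothing in `M` dominates `i`, then `rep i` can be added to `F`. By maximality it already
      -- lies in `F`, so `i` is in `M` and dominates itself.
      ... | no none = i , subst (M ∋_) (π-rep i) (down v (max G indG F⊆G v (G⁺ v (inj₂ refl)))) ,
                      c-refl i
        where
        v = rep i
        G : Subset (V H)
        G w = F w ∨ ⌊ w ≟ᵥ v ⌋
        G⁺ : ∀ w → F ∋ w ⊎ w ≡ v → G ∋ w
        G⁺ w = Equivalence.from T-∨ ∘ Sum.map₂ fromWitness
        G⁻ : ∀ w → G ∋ w → F ∋ w ⊎ w ≡ v
        G⁻ w = Sum.map₂ toWitness ∘ Equivalence.to T-∨
        F⊆G : F ⊆ G
        F⊆G w = G⁺ w ∘ inj₁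
        ¬c : ∀ w → F ∋ w → ¬ T (c (π w) (π v))
        ¬c w Fw t = none (lose (xs-complete (π w)) (down w Fw , subst (T ∘ c (π w)) (π-rep i) t))
        indG : Ind H G
        indG w w′ Gw Gw′ adj with Adj⁻ adj | G⁻ w Gw | G⁻ w′ Gw′
        ... | _         | inj₁ Fw   | inj₁ Fw′  = ind w w′ Fw Fw′ adj
        ... | _ , cww′  | inj₁ Fw   | inj₂ refl = ¬c w Fw cww′
        ... | _ , cww′  | inj₂ refl | inj₁ Fw′  = ¬c w′ Fw′ (c-sym cww′)
        ... | w≢w′ , _  | inj₂ refl | inj₂ refl = w≢w′ refl

    module _ {facets : List (List A)} (facets-shelling : ShellingList facets)
             (facets-MIS : All (MIS all-A) facets) (facets-listed : Listed facets)
             {d : ℕ} (facets-pure : All (λ l → length l ≡ d) facets) where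

      choice-MIS : ∀ {E l} → l ∈ facets → map π E ≡ l → MISᵥ (λ _ → true) E
      choice-MIS l∈ πE≡l = lift-MIS shadow-all (All.lookup facets-MIS l∈) _ πE≡l _

      -- Twins are adjacent, so a facet meets each fibre at most once, and a section over its image
      -- recovers all of it.
      facet⇒choice : ∀ F → Facet (Ind H) F → ∃ λ E → map π E ∈ facets × ⟦ E ⟧ ≐ F
      facet⇒choice F facet@(ind , _) with facet⇒maximal facet
      ... | M , max , down , up
        with section {U = F} (filter (T? ∘ M) xs) (λ i∈ → up _ (proj₂ (∈-filter⁻ (T? ∘ M) {xs = xs} i∈)))
      ...   | E , πE≡ , E⊆F =
        E , subst (_∈ facets) (sym πE≡) (maximal⇒∈ facets-listed max) , (λ v Ev → E⊆F (⟦⟧⁻ Ev)) , F⊆E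
        where
        F⊆E : F ⊆ ⟦ E ⟧
        F⊆E v Fv with ∈-map⁻ π (subst (π v ∈_) (sym πE≡)
                                     (∈-filter⁺ (T? ∘ M) (xs-complete (π v)) (down v Fv)))
        ... | w , w∈E , πv≡πw with v ≟ᵥ w
        ...   | yes refl = ⟦⟧⁺ w∈E
        ...   | no v≢w = contradiction (Adj⁺ v≢w (subst (T ∘ c (π v)) πv≡πw (c-refl _)))
                                       (ind v w Fv (E⊆F w∈E))

      facet-↔ : ∀ F → Facet (Ind H) F → Σ (V H) (F ∋_) ↔ Fin d
      facet-↔ F facet =
        let E , l∈ , E⊆F , F⊆E = facet⇒choice F facet
        in subst (λ n → Σ (V H) (F ∋_) ↔ Fin n)
             (trans (sym (length-map π E)) (All.lookup facets-pure l∈))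
             (enumerates-↔ (MISᵥ-unique (choice-MIS l∈ refl)) (λ v → E⊆F v ∘ ⟦⟧⁺) (λ v → ⟦⟧⁻ ∘ F⊆E v))

      shellable : Shellable (Ind H)
      shellable =
        (λ F G fF fG → ↔-trans (facet-↔ F fF) (↔-sym (facet-↔ G fG))) ,
        _ , _ ,
        shelling _≟ᵥ_ (lift-shelling (λ l∈ → MIS-unique (All.lookup facets-MIS l∈)) facets-shelling)
          (λ E E∈ → let l , l∈ , E∈l = find (∈-concatMap⁻ choices {facets} E∈) in
            MIS-facet restricts-all (choice-MIS l∈ (∈-choices⁻ l E∈l)))
          (λ F facet → let E , l∈ , E≐F = facet⇒choice F facet in
            E , ∈-concatMap⁺ choices (lose l∈ (∈-choices⁺ E)) , E≐F)

-- The graph C₁₆(1,4,8) and its finite checks.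

open DecMembership ℕ._≟_ using (_∈?_)

-- The distances at which two vertices of C₁₆(1,4,8) are equal or adjacent.
residues : List ℕ
residues = 0 ∷ 1 ∷ 4 ∷ 8 ∷ 12 ∷ 15 ∷ []

closedAdj : Fin 16 → Fin 16 → Bool
closedAdj i j = ⌊ ∣ toℕ i - toℕ j ∣ ∈? residues ⌋

closedAdj-refl : ∀ i → T (closedAdj i i)
closedAdj-refl = from-yes (all? λ i → T? (closedAdj i i))

closedAdj-sym : ∀ i j → T (closedAdj i j) → T (closedAdj j i)
closedAdj-sym i j = subst (λ d → T ⌊ d ∈? residues ⌋) (ℕₚ.∣-∣-comm (toℕ i) (toℕ j))

open BlowupTheory _≟_ closedAdj closedAdj-refl (λ {i} {j} → closedAdj-sym i j)
  (allFin 16) (allFin⁺ 16) ∈-allFin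

-- The entries are to be given in increasing order: `Listed` compares lists literally with sublists
-- of `allFin 16`.
facet : ℕ × ℕ × ℕ × ℕ → List (Fin 16)
facet (i , j , k , l) = map (_mod 16) (i ∷ j ∷ k ∷ l ∷ [])

-- All facets of Ind(C₁₆(1,4,8)), found by computer search; read from the end it is a shelling.
facets : List (List (Fin 16))
facets = map facet (
  (1 , 4 , 10 , 15) ∷ (1 , 4 , 6 , 15) ∷ (1 , 4 , 6 , 11) ∷ (4 , 10 , 13 , 15) ∷ (1 , 4 , 11 , 14) ∷
  (8 , 10 , 13 , 15) ∷ (3 , 8 , 10 , 13) ∷ (3 , 6 , 8 , 13) ∷ (1 , 8 , 11 , 14) ∷ (0 , 3 , 6 , 13) ∷
  (1 , 3 , 8 , 14) ∷ (4 , 9 , 11 , 14) ∷ (0 , 3 , 6 , 9) ∷ (0 , 3 , 9 , 14) ∷ (1 , 6 , 8 , 11) ∷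
  (6 , 8 , 11 , 13) ∷ (1 , 3 , 6 , 8) ∷ (6 , 8 , 13 , 15) ∷ (1 , 4 , 7 , 14) ∷ (3 , 5 , 8 , 14) ∷
  (0 , 9 , 11 , 14) ∷ (0 , 3 , 5 , 14) ∷ (0 , 7 , 9 , 14) ∷ (0 , 6 , 11 , 13) ∷ (4 , 6 , 11 , 13) ∷
  (3 , 5 , 12 , 14) ∷ (0 , 6 , 9 , 11) ∷ (0 , 2 , 9 , 11) ∷ (4 , 7 , 9 , 14) ∷ (1 , 6 , 8 , 15) ∷
  (7 , 9 , 12 , 14) ∷ (4 , 6 , 13 , 15) ∷ (4 , 6 , 9 , 11) ∷ (2 , 4 , 7 , 9) ∷ (1 , 3 , 8 , 10) ∷
  (4 , 6 , 9 , 15) ∷ (1 , 4 , 7 , 10) ∷ (0 , 3 , 10 , 13) ∷ (5 , 8 , 11 , 14) ∷ (2 , 4 , 9 , 11) ∷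
  (0 , 3 , 5 , 10) ∷ (4 , 7 , 10 , 13) ∷ (3 , 5 , 8 , 10) ∷ (2 , 4 , 7 , 13) ∷ (2 , 4 , 9 , 15) ∷
  (1 , 8 , 10 , 15) ∷ (0 , 7 , 10 , 13) ∷ (0 , 2 , 7 , 9) ∷ (5 , 8 , 10 , 15) ∷ (2 , 4 , 13 , 15) ∷
  (0 , 2 , 7 , 13) ∷ (0 , 2 , 11 , 13) ∷ (3 , 9 , 12 , 14) ∷ (0 , 5 , 11 , 14) ∷ (3 , 6 , 9 , 12) ∷
  (2 , 7 , 9 , 12) ∷ (0 , 5 , 7 , 10) ∷ (0 , 5 , 7 , 14) ∷ (5 , 7 , 12 , 14) ∷ (1 , 7 , 12 , 14) ∷
  (3 , 5 , 10 , 12) ∷ (1 , 7 , 10 , 12) ∷ (2 , 8 , 13 , 15) ∷ (1 , 3 , 10 , 12) ∷ (0 , 2 , 5 , 7) ∷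
  (5 , 7 , 10 , 12) ∷ (1 , 10 , 12 , 15) ∷ (1 , 3 , 12 , 14) ∷ (1 , 3 , 6 , 12) ∷ (0 , 2 , 5 , 11) ∷
  (1 , 6 , 12 , 15) ∷ (2 , 4 , 11 , 13) ∷ (6 , 9 , 12 , 15) ∷ (2 , 8 , 11 , 13) ∷ (2 , 9 , 12 , 15) ∷
  (2 , 5 , 8 , 11) ∷ (2 , 5 , 7 , 12) ∷ (5 , 10 , 12 , 15) ∷ (2 , 5 , 8 , 15) ∷ (2 , 5 , 12 , 15) ∷
  [])

facets-pure : All (λ l → length l ≡ 4) facets
facets-pure = from-yes (All.all? (λ l → length l ℕ.≟ 4) facets)

facets-MIS : All (MIS all-A) facets
facets-MIS = from-yes (All.all? (mis? all-A) facets)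

facets-listed : Listed facets
facets-listed = from-yes (listed? facets)

facets-shelling : ShellingList facets
facets-shelling = from-yes (shellingList? _≟_ facets)

-- χ = -1 although the rank 4 is even.
¬eulerNonneg-─ : ∀ i → ¬ EulerNonneg (all-A ─ i)
¬eulerNonneg-─ i nonneg =
  let l , _ , m , χ≡-1 = find (negative i) in case subst (0ℤ ℤ.≤_) χ≡-1 (nonneg l m) of λ ()
  where
  negative : ∀ i → Any (λ l → MIS (all-A ─ i) l × signed l (χ (allFin 16) (all-A ─ i)) ≡ -1ℤ) facets
  negative = from-yes (all? λ i → any? (λ l → mis? (all-A ─ i) l ×-dec
    (signed l (χ (allFin 16) (all-A ─ i)) ℤ.≟ -1ℤ)) facets)

blowup-shellable : ∀ {H} → Blowup H → Shellable (Ind H)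
blowup-shellable B = shellable B facets-shelling facets-MIS facets-listed facets-pure

blowup-¬VD : ∀ {H} → Blowup H → ¬ VertexDecomposable (Ind H)
blowup-¬VD B = ¬VD B {zero} {suc zero} (λ ()) _ ¬eulerNonneg-─

adj? : ∀ i j → Dec (Adj G₁₆ i j)
adj? i j = (∣ toℕ i - toℕ j ∣ ∈? _) ⊎-dec (16 ∸ ∣ toℕ i - toℕ j ∣ ∈? _)

G₁₆-Adj⁻ : ∀ i j → Adj G₁₆ i j → i ≢ j × T (closedAdj i j)
G₁₆-Adj⁻ = from-yes (all? λ i → all? λ j → adj? i j →-dec (¬? (i ≟ j) ×-dec T? (closedAdj i j)))

G₁₆-Adj⁺ : ∀ i j → i ≢ j → T (closedAdj i j) → Adj G₁₆ i j
G₁₆-Adj⁺ = from-yes (all? λ i → all? λ j → ¬? (i ≟ j) →-dec (T? (closedAdj i j) →-dec adj? i j))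

-- Expansions and lexicographic products as blow-ups.

expansion-blowup : (s : Fin 16 → ℕ) → (∀ i → 1 ≤ s i) → Blowup (Expansion G₁₆ s)
expansion-blowup s s≥1 = record
  { _≟ᵥ_         = ≡-dec _≟_ _≟_
  ; π            = proj₁
  ; fibre        = λ i → map (i ,_) (allFin (s i))
  ; fibre-unique = λ i → Unique-map⁺ (λ { refl → refl }) (allFin⁺ (s i))
  ; ∈-fibre      = λ (i , k) → ∈-map⁺ (i ,_) (∈-allFin k)
  ; π-fibre      = λ v∈ → cong proj₁ (proj₂ (proj₂ (∈-map⁻ _ v∈)))
  ; rep          = λ i → i , fromℕ< (s≥1 i)
  ; π-rep        = λ _ → refl
  ; Adj⁻         = λ { {i , _} {j , _} (inj₁ adj) →
                         let i≢j , cij = G₁₆-Adj⁻ i j adj in i≢j ∘ cong proj₁ , cij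
                     ; {i , _} (inj₂ (refl , v≢w)) → v≢w , closedAdj-refl i }
  ; Adj⁺         = λ { {i , _} {j , _} v≢w cij → case i ≟ j of λ
                       { (yes i≡j) → inj₂ (i≡j , v≢w)
                       ; (no i≢j)  → inj₁ (G₁₆-Adj⁺ i j i≢j cij) } }
  }

expansion≅lex : ∀ G m → Expansion G (λ _ → m) ≅ Lex G (K m)
expansion≅lex G m = ↔-refl , λ v w → mk⇔
  (λ { (inj₁ adj) → inj₁ adj ; (inj₂ (refl , v≢w)) → inj₂ (refl , λ { refl → v≢w refl }) })
  (λ { (inj₁ adj) → inj₁ adj ; (inj₂ (i≡j , k≢l)) → inj₂ (i≡j , λ { refl → k≢l refl }) })

-- The circulant graph of order 16m.

residue⇔closedAdj : ∀ d (i j : Fin 16) → (d + toℕ j) % 16 ≡ toℕ i →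
                    d % 16 ∈ residues ⇔ T (closedAdj i j)
residue⇔closedAdj d i j eq =
  let to , from = table (d mod 16) j i eq′
  in mk⇔ (to ∘ subst (_∈ residues) (sym r≡)) (subst (_∈ residues) r≡ ∘ from)
  where
  -- Only the residue `r` of `d` matters, so evaluation over all triples decides. `residues` is
  -- closed under negation modulo 16, so the difference of `i` and `j` modulo 16 and their absolute
  -- distance pass the same test.
  table : ∀ (r j i : Fin 16) → (toℕ r + toℕ j) % 16 ≡ toℕ i →
          (toℕ r ∈ residues → T (closedAdj i j)) × (T (closedAdj i j) → toℕ r ∈ residues)
  table = from-yes (all? {n = 16} λ r → all? λ j → all? λ i → ((toℕ r + toℕ j) % 16 ℕ.≟ toℕ i) →-dec
    (((toℕ r ∈? residues) →-dec T? (closedAdj i j)) ×-dec (T? (closedAdj i j) →-dec (toℕ r ∈? residues))))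
  r≡ : toℕ (d mod 16) ≡ d % 16
  r≡ = toℕ-fromℕ< (m%n<n d 16)
  eq′ : (toℕ (d mod 16) + toℕ j) % 16 ≡ toℕ i
  eq′ = begin
    (toℕ (d mod 16) + toℕ j) % 16     ≡⟨ cong (λ r → (r + toℕ j) % 16) r≡ ⟩
    (d % 16 + toℕ j) % 16             ≡⟨ %-distribˡ-+ (d % 16) (toℕ j) 16 ⟩
    (d % 16 % 16 + toℕ j % 16) % 16   ≡⟨ cong (λ r → (r + toℕ j % 16) % 16) (m%n%n≡m%n d 16) ⟩
    (d % 16 + toℕ j % 16) % 16        ≡⟨ %-distribˡ-+ d (toℕ j) 16 ⟨
    (d + toℕ j) % 16                  ≡⟨ eq ⟩
    toℕ i                             ∎
    where open ≡-Reasoning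

module _ (m : ℕ) where

  order : ℕ
  order = m * 16

  connectionSet : List ℕ
  connectionSet = filter (λ k → k % 16 ∈? residues) (map suc (upTo (order / 2)))

  ∈-connectionSet⁺ : ∀ {k} → 1 ≤ k → k ≤ order / 2 → k % 16 ∈ residues → k ∈ connectionSet
  ∈-connectionSet⁺ {suc k} _ k<order/2 =
    ∈-filter⁺ (λ k → k % 16 ∈? residues) (∈-map⁺ suc (∈-upTo⁺ k<order/2))

  ∈-connectionSet⁻ : ∀ {k} → k ∈ connectionSet → (1 ≤ k × k ≤ order / 2) × k % 16 ∈ residues
  ∈-connectionSet⁻ k∈ with ∈-filter⁻ (λ k → k % 16 ∈? residues) {xs = map suc (upTo (order / 2))} k∈
  ... | k∈upTo , r with ∈-map⁻ suc k∈upTo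
  ...   | _ , k′∈ , refl = (s≤s z≤n , ∈-upTo⁻ k′∈) , r

  column : Fin order → Fin 16
  column a = proj₂ (remQuot {m} 16 a)

  column≡% : ∀ a → toℕ (column a) ≡ toℕ a % 16
  column≡% a = begin
    toℕ j                       ≡⟨ m<n⇒m%n≡m (toℕ<n j) ⟨
    toℕ j % 16                  ≡⟨ [m+kn]%n≡m%n (toℕ j) (toℕ k) 16 ⟨
    (toℕ j + toℕ k * 16) % 16   ≡⟨ cong (_% 16) (ℕₚ.+-comm (toℕ j) (toℕ k * 16)) ⟩
    (toℕ k * 16 + toℕ j) % 16   ≡⟨ cong (λ n → (n + toℕ j) % 16) (ℕₚ.*-comm (toℕ k) 16) ⟩
    (16 * toℕ k + toℕ j) % 16   ≡⟨ cong (_% 16) (toℕ-combine k j) ⟨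
    toℕ (combine k j) % 16      ≡⟨ cong (λ a → toℕ a % 16) (combine-remQuot {m} 16 a) ⟩
    toℕ a % 16                  ∎
    where
    open ≡-Reasoning
    k = proj₁ (remQuot {m} 16 a)
    j = column a

  -- The multiple of 16 allows for going around the cycle: `k` is 0 for the distance itself and `m`
  -- for its complement to `order`.
  translate⇔closedAdj : ∀ d k a b → d + toℕ b ≡ toℕ a + k * 16 →
                        d % 16 ∈ residues ⇔ T (closedAdj (column a) (column b))
  translate⇔closedAdj d k a b eq = residue⇔closedAdj d (column a) (column b) (begin
    (d + toℕ (column b)) % 16          ≡⟨ cong (λ j → (d + j) % 16) (column≡% b) ⟩
    (d + toℕ b % 16) % 16              ≡⟨ %-distribˡ-+ d (toℕ b % 16) 16 ⟩
    (d % 16 + toℕ b % 16 % 16) % 16    ≡⟨ cong (λ r → (d % 16 + r) % 16) (m%n%n≡m%n (toℕ b) 16) ⟩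
    (d % 16 + toℕ b % 16) % 16         ≡⟨ %-distribˡ-+ d (toℕ b) 16 ⟨
    (d + toℕ b) % 16                   ≡⟨ cong (_% 16) eq ⟩
    (toℕ a + k * 16) % 16              ≡⟨ [m+kn]%n≡m%n (toℕ a) k 16 ⟩
    toℕ a % 16                         ≡⟨ column≡% a ⟨
    toℕ (column a)                     ∎)
    where open ≡-Reasoning

  dist : Fin order → Fin order → ℕ
  dist a b = ∣ toℕ a - toℕ b ∣

  dist<order : ∀ a b → dist a b < order
  dist<order a b = ℕₚ.≤-<-trans (ℕₚ.∣m-n∣≤m⊔n (toℕ a) (toℕ b)) (ℕₚ.⊔-lub (toℕ<n a) (toℕ<n b))

  DetectedBy : ℕ → Fin order → Fin order → Set
  DetectedBy d a b = d % 16 ∈ residues ⇔ T (closedAdj (column a) (column b))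

  DetectedBy-sym : ∀ d {a b} → DetectedBy d a b → DetectedBy d b a
  DetectedBy-sym d {a} {b} det =
    ⇔.trans det (mk⇔ (closedAdj-sym (column a) (column b)) (closedAdj-sym (column b) (column a)))

  -- Modulo 16 the distance carries `b` to `a`, and its complement to `order` carries `a` back to
  -- `b`; the second case therefore swaps the roles and uses symmetry.
  dist-detects-≥ : ∀ {a b} → toℕ b ≤ toℕ a → DetectedBy (dist a b) a b × DetectedBy (order ∸ dist a b) a b
  dist-detects-≥ {a} {b} b≤a =
    translate⇔closedAdj (dist a b) 0 a b (trans dist+b≡a (sym (ℕₚ.+-identityʳ (toℕ a)))) ,
    DetectedBy-sym (order ∸ dist a b) (translate⇔closedAdj (order ∸ dist a b) m b a (begin
      order ∸ dist a b + toℕ a                  ≡⟨ cong (order ∸ dist a b +_) dist+b≡a ⟨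
      order ∸ dist a b + (dist a b + toℕ b)     ≡⟨ ℕₚ.+-assoc (order ∸ dist a b) (dist a b) (toℕ b) ⟨
      order ∸ dist a b + dist a b + toℕ b       ≡⟨ cong (_+ toℕ b) (ℕₚ.m∸n+n≡m (ℕₚ.<⇒≤ (dist<order a b))) ⟩
      order + toℕ b                             ≡⟨ ℕₚ.+-comm order (toℕ b) ⟩
      toℕ b + order                             ∎))
    where
    open ≡-Reasoning
    dist+b≡a : dist a b + toℕ b ≡ toℕ a
    dist+b≡a = trans (cong (_+ toℕ b) (ℕₚ.m≤n⇒∣n-m∣≡n∸m b≤a)) (ℕₚ.m∸n+n≡m b≤a)

  dist-detects : ∀ a b → DetectedBy (dist a b) a b × DetectedBy (order ∸ dist a b) a b
  dist-detects a b with ℕₚ.≤-total (toℕ b) (toℕ a)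
  ... | inj₁ b≤a = dist-detects-≥ b≤a
  ... | inj₂ a≤b = let near , far = dist-detects-≥ a≤b in
    subst (λ d → DetectedBy d a b) comm (DetectedBy-sym (dist b a) near) ,
    subst (λ d → DetectedBy (order ∸ d) a b) comm (DetectedBy-sym (order ∸ dist b a) far)
    where comm = ℕₚ.∣-∣-comm (toℕ b) (toℕ a)

  circulant-Adj⁻ : ∀ {a b} → Adj (Circulant order connectionSet) a b →
                   a ≢ b × T (closedAdj (column a) (column b))
  circulant-Adj⁻ {a} {b} (inj₁ d∈) =
    let (1≤d , _) , r = ∈-connectionSet⁻ d∈ in
    (λ { refl → ℕₚ.<⇒≢ 1≤d (sym (ℕₚ.∣n-n∣≡0 (toℕ a))) }) ,
    Equivalence.to (proj₁ (dist-detects a b)) r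
  circulant-Adj⁻ {a} {b} (inj₂ order∸d∈) =
    let (1≤order∸d , order∸d≤order/2) , r = ∈-connectionSet⁻ order∸d∈ in
    -- For equal vertices the complement is `order` itself, which is positive and so exceeds
    -- `order / 2`.
    (λ { refl → ℕₚ.<⇒≱ (m/n<m order 2 {{ℕ.>-nonZero (ℕₚ.≤-<-trans z≤n (toℕ<n a))}} (s≤s (s≤s z≤n)))
                  (subst (λ d → order ∸ d ≤ order / 2) (ℕₚ.∣n-n∣≡0 (toℕ a)) order∸d≤order/2) }) ,
    Equivalence.to (proj₂ (dist-detects a b)) r

  circulant-Adj⁺ : ∀ {a b} → a ≢ b → T (closedAdj (column a) (column b)) →
                   Adj (Circulant order connectionSet) a b
  circulant-Adj⁺ {a} {b} a≢b cab with ℕₚ.≤-<-connex (dist a b) (order / 2)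
  ... | inj₁ d≤order/2 = inj₁ (∈-connectionSet⁺
    (ℕₚ.n≢0⇒n>0 (a≢b ∘ toℕ-injective ∘ ℕₚ.∣m-n∣≡0⇒m≡n)) d≤order/2
    (Equivalence.from (proj₁ (dist-detects a b)) cab))
  ... | inj₂ order/2<d = inj₂ (∈-connectionSet⁺
    (ℕₚ.m<n⇒0<n∸m (dist<order a b))
    -- `order` exceeds twice its half by at most one, and the strict inequality
    -- `order / 2 < dist a b` absorbs that one.
    (ℕₚ.m≤n+o⇒m∸n≤o order (dist a b) (begin
      order                         ≡⟨ m≡m%n+[m/n]*n order 2 ⟩
      order % 2 + order / 2 * 2         ≤⟨ ℕₚ.+-monoˡ-≤ (order / 2 * 2) (ℕₚ.≤-pred (m%n<n order 2)) ⟩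
      1 + order / 2 * 2             ≡⟨ double (order / 2) ⟩
      suc (order / 2) + order / 2       ≤⟨ ℕₚ.+-monoˡ-≤ (order / 2) order/2<d ⟩
      dist a b + order / 2          ∎))
    (Equivalence.from (proj₂ (dist-detects a b)) cab))
    where
    open ℕₚ.≤-Reasoning
    double : ∀ k → 1 + k * 2 ≡ suc k + k
    double = ℕ-Solver.solve-∀

  column-combine : ∀ k i → column (combine k i) ≡ i
  column-combine k i = cong proj₂ (remQuot-combine {m} k i)

  circulant-blowup : 1 ≤ m → Blowup (Circulant order connectionSet)
  circulant-blowup m≥1 = record
    { _≟ᵥ_         = _≟_
    ; π            = column
    ; fibre        = λ i → map (λ k → combine k i) (allFin m)
    ; fibre-unique = λ i → Unique-map⁺ (λ {k} {l} → combine-injectiveˡ k i l i) (allFin⁺ m)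
    ; ∈-fibre      = λ a → subst (_∈ map (λ k → combine k (column a)) (allFin m))
                             (combine-remQuot {m} 16 a)
                             (∈-map⁺ (λ k → combine k (column a)) (∈-allFin (proj₁ (remQuot {m} 16 a))))
    ; π-fibre      = λ {i} a∈ → case ∈-map⁻ (λ k → combine k i) a∈ of λ
                       { (k , _ , refl) → column-combine k i }
    ; rep          = combine (fromℕ< m≥1)
    ; π-rep        = column-combine (fromℕ< m≥1)
    ; Adj⁻         = circulant-Adj⁻
    ; Adj⁺         = circulant-Adj⁺
    }

  -- Copy `k` of vertex `i` goes to 16k + i, which lies in column `i`; compatibility with the
  -- projections is enough for blow-ups.
  expansion≅circulant : 1 ≤ m → Expansion G₁₆ (λ _ → m) ≅ Circulant order connectionSet
  expansion≅circulant m≥1 = blowup-≅ (expansion-blowup (λ _ → m) (λ _ → m≥1)) (circulant-blowup m≥1)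
    (mk↔ₛ′ (λ (i , k) → combine k i) (swap ∘ remQuot {m} 16) (combine-remQuot {m} 16)
           (λ (i , k) → cong swap (remQuot-combine {m} k i)))
    (λ (i , k) → column-combine k i)

theorem4p4 : ((s : Fin 16 → ℕ) → (∀ i → 1 ≤ s i) →
    Shellable (Ind (Expansion G₁₆ s)) ×
    ¬ VertexDecomposable (Ind (Expansion G₁₆ s))) ×
    ((m : ℕ) → 1 ≤ m →
    (Expansion G₁₆ (λ _ → m) ≅ Lex G₁₆ (K m)) ×
    Σ ℕ (λ N → Σ (List ℕ) (λ S →
    ValidConnectionSet N S ×
    (Lex G₁₆ (K m) ≅ Circulant N S) ×
    Shellable (Ind (Circulant N S)) ×
    ¬ VertexDecomposable (Ind (Circulant N S)))))
theorem4p4 =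
  (λ s s≥1 → let B = expansion-blowup s s≥1 in blowup-shellable B , blowup-¬VD B) ,
  λ m m≥1 →
    let B = circulant-blowup m m≥1
        f , f-adj = expansion≅circulant m m≥1
        _ , g-adj = expansion≅lex G₁₆ m
    in expansion≅lex G₁₆ m , order m , connectionSet m ,
       All.tabulate (proj₁ ∘ ∈-connectionSet⁻ m) ,
       -- `expansion≅lex` is the identity on vertices, so `f` also serves for the lexicographic
       -- product and only the adjacency equivalences are composed.
       (f , λ v w → ⇔.trans (⇔.sym (g-adj v w)) (f-adj v w)) ,
       blowup-shellable B , blowup-¬VD B
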